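{- There exist constants $c'>1$ and $\Delta_0$ such that for all integers $\Delta\ge\Delta_0$ and $n\ge\Delta$ the following holds. There exist a bipartite digraph $D_0=(A\cup B,E)$ with $|A|=|B|\le n$ and maximum degree $\Delta$, all of whose edges are directed from $A$ to $B$, and a tournament $R$ on $\lfloor (c')^{\Delta}n\rfloor$ vertices, such that for any $A'\subseteq A$ and $B'\subseteq B$ the following hold. 1. If $|A'|,|B'|\ge 0.98|A|$, then there is no copy of $D_0[A'\cup B']$ in $R$. 2. If $|A'|,|B'|\ge 0.01|A|$, then $e_{D_0}(A',B')>0$.
   Context: A tournament is an orientation of the edges of a finite complete graph. The maximum degree of a digraph is the maximum degree of its underlying undirected graph. $D_0[A'\cup B']$ is the induced subdigraph on $A'\cup B'$. A copy of a digraph $D$ in $R$ is a (not necessarily induced) subdigraph of $R$ isomorphic to $D$. $e_{D_0}(A',B')$ denotes the number of pairs in $A'\times B'$ that are edges of $D_0$. -}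

module Defs where

open import Algebra.Definitions.RawSemiring using (_^_)
open import Data.Fin using (Fin)
open import Data.Fin.Subset using (Subset; _∈_; _⊆_; _∩_; _∪_; ∣_∣; Empty)
open import Data.Fin.Subset.Properties using (_∈?_; x∈p∩q⁺)
open import Data.Integer using (+_)
open import Data.List using (map; length; filter; allFin; cartesianProduct)
open import Data.List.Extrema.Nat using (max)
open import Data.Nat using (ℕ)
open import Data.Product using (Σ; ∃; _×_; _,_; proj₁; proj₂)
open import Data.Rational using (ℚ; +-*-rawSemiring; _/_)
open import Data.Sum using (_⊎_)
open import Function.Bundles using (_↔_; _⇔_; Inverse)
open import Level using (0ℓ)
open import Relation.Binary.Core using (Rel)
open import Relation.Binary.Definitions using (Decidable; Irreflexive)
open import Relation.Binary.PropositionalEquality using (_≡_; _≢_)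
open import Relation.Nullary using (¬_)
open import Relation.Nullary.Decidable using (_×-dec_; _⊎-dec_)

-- A finite loopless digraph.  Its vertex set V is a subset of an ambient
-- finite set Fin N, so that subdigraphs of a digraph are digraphs over the
-- same ambient set; elements of Fin N outside V are not vertices.
record Digraph (N : ℕ) : Set₁ where
  field
    V          : Subset N
    E          : Rel (Fin N) 0ℓ
    E?         : Decidable E
    E-vertices : ∀ {u v} → E u v → u ∈ V × v ∈ V
    E-irrefl   : Irreflexive _≡_ E

open Digraph public

Vertex : ∀ {N} → Digraph N → Set
Vertex D = ∃ λ v → v ∈ V D

order : ∀ {N} → Digraph N → ℕ
order D = ∣ V D ∣

degree : ∀ {N} → Digraph N → Fin N → ℕ
degree {N} D v = length (filter (λ u → E? D u v ⊎-dec E? D v u) (allFin N))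

-- Ambient elements that are not vertices have degree 0, so they do not
-- affect the maximum.
maxDegree : ∀ {N} → Digraph N → ℕ
maxDegree {N} D = max 0 (map (degree D) (allFin N))

edgesBetween : ∀ {N} → Digraph N → Subset N → Subset N → ℕ
edgesBetween {N} D S T =
  length (filter (λ (u , v) → (u ∈? S) ×-dec (v ∈? T) ×-dec E? D u v)
                 (cartesianProduct (allFin N) (allFin N)))

induced : ∀ {N} → Digraph N → Subset N → Digraph N
induced D S = record
  { V          = V D ∩ S
  ; E          = λ u v → E D u v × u ∈ S × v ∈ S
  ; E?         = λ u v → E? D u v ×-dec (u ∈? S) ×-dec (v ∈? S)
  ; E-vertices = λ (e , u∈S , v∈S) →
      x∈p∩q⁺ (proj₁ (E-vertices D e) , u∈S) ,
      x∈p∩q⁺ (proj₂ (E-vertices D e) , v∈S)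
  ; E-irrefl   = λ u≡v (e , _) → E-irrefl D u≡v e
  }

record DirectedBipartite {N} (D : Digraph N) (A B : Subset N) : Set where
  field
    vertices : V D ≡ A ∪ B
    disjoint : Empty (A ∩ B)
    directed : ∀ {u v} → E D u v → u ∈ A × v ∈ B

Tournament : ∀ {N} → Digraph N → Set
Tournament R = ∀ {u v} → u ∈ V R → v ∈ V R → u ≢ v →
  (E R u v × ¬ E R v u) ⊎ (¬ E R u v × E R v u)

record _Subdigraph_ {N} (H R : Digraph N) : Set where
  field
    V-⊆ : V H ⊆ V R
    E-⊆ : ∀ {u v} → E H u v → E R u v

record _≅_ {M N} (D : Digraph M) (H : Digraph N) : Set where
  field
    bijection : Vertex D ↔ Vertex H
    edges     : ∀ (x y : Vertex D) →
      E D (proj₁ x) (proj₁ y) ⇔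
      E H (proj₁ (Inverse.to bijection x)) (proj₁ (Inverse.to bijection y))

Copy : ∀ {M N} → Digraph M → Digraph N → Set₁
Copy {N = N} D R = Σ (Digraph N) λ H → (H Subdigraph R) × (D ≅ H)

infixr 8 _^ℚ_
_^ℚ_ : ℚ → ℕ → ℚ
c ^ℚ k = _^_ +-*-rawSemiring c k

fromℕ : ℕ → ℚ
fromℕ n = + n / 1

{-# OPTIONS --safe #-}

-- R is the blow-up of a random tournament T on 2^q vertices, q proportional to Δ, whose parts
-- have ⌊n/Δ⌋ vertices; D₀ is a random bipartite graph in which every vertex of A chooses a
-- small multiple of Δ neighbours.  In T, of the pairs formed by two sets of 16q vertices at
-- most 3/4 are directed from the first to the second.  A copy of most of D₀ in R labels its vertices by the parts of R,
-- and each part takes few vertices; so by the property of T the labels forbid a positive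
-- fraction of the pairs in A × B to be edges.  For a given labelling a random D₀ avoids the
-- forbidden pairs with probability exp(-cΔn), while there are only 2^(O(qn)) labellings.
-- The second condition is the case of two constant labels without an edge between them.
module Submission where

open import Defs
open import Data.Bool using (Bool; true; false; not; if_then_else_; _∧_; _∨_; T)
import Data.Bool as Bool
import Data.Bool.Properties as Boolₚ
open import Data.Empty using (⊥)
open import Data.Fin using (Fin; zero; suc; toℕ)
import Data.Fin as Fin
import Data.Fin.Properties as Finₚ
open import Data.Fin.Subset using (Subset; _∈_; _⊆_; _∪_; ⊤; ∣_∣; inside; outside)
open import Data.Fin.Subset.Properties using (_∈?_; ∈⊤; ∣⊤∣≡n; x∈p∪q⁺; x∈p∩q⁺; x∈p∩q⁻)
import Data.Integer as ℤ
import Data.Integer.Properties as ℤₚ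
open import Data.Integer.GCD using (gcd)
open import Data.Integer.Tactic.RingSolver using () renaming (solve-∀ to ℤ-solve-∀)
open import Data.List
  using (List; []; _∷_; _++_; map; length; filter; allFin; tabulate; cartesianProductWith; cartesianProduct)
import Data.List.Properties as Listₚ
import Data.List.Membership.Propositional as List
open import Data.List.Membership.Propositional using (lose)
open import Data.List.Membership.Propositional.Properties
  using (∈-allFin; ∈-cartesianProductWith⁺; ∈-cartesianProduct⁺; ∈-map⁺; ∈-map⁻; ∈-++⁺ˡ; ∈-++⁺ʳ; ∈-++⁻; ∈-cartesianProduct⁻; ∈-filter⁺; ∈-filter⁻; ∈-length)
open import Data.List.Extrema.Nat using (max≤v⁺; v≤max⁺)
import Data.List.Relation.Unary.All as All
import Data.List.Relation.Unary.All.Properties as All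
open import Data.List.Relation.Unary.Any using (here; there)
import Data.List.Relation.Unary.Any.Properties as Any
open import Data.Maybe as Maybe using (Maybe; just; nothing)
open import Data.Nat
  using (ℕ; zero; suc; _+_; _*_; _∸_; _^_; _≤_; _≥_; _>_; _<_; z≤n; s≤s; s≤s⁻¹; _≤?_; _<?_; _<ᵇ_; _≤ᵇ_; NonZero; >-nonZero; >-nonZero⁻¹)
open import Data.Nat.DivMod using (_/_; m/n*n≤m; m%n<n; m≡m%n+[m/n]*n; m*n/n≡m; /-monoˡ-≤)
open import Data.Nat.Properties
open import Data.Nat.ListAction using (sum; product)
open import Data.Nat.Tactic.RingSolver using (solve-∀)
open import Data.Product using (Σ; ∃; _×_; _,_; proj₁; proj₂)
open import Data.Rational as ℚ using (ℚ; 1ℚ; floor)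
import Data.Rational.Properties as ℚₚ
open import Data.Sum using (_⊎_; inj₁; inj₂)
open import Data.Vec as Vec using (Vec; []; _∷_; lookup)
import Data.Vec.Properties as Vecₚ
open import Data.Vec.Properties.WithK using ([]=-irrelevant)
open import Function using (_∘_; id)
open import Function.Bundles using (Inverse; Injection; Equivalence)
open import Function.Properties.Inverse using (↔⇒↣)
open import Relation.Binary.PropositionalEquality
open import Relation.Nullary using (¬_; Dec; yes; no; does; contradiction)
open import Relation.Nullary.Decidable using (dec-true; dec-false; toWitness; _×-dec_; _⊎-dec_)
open import Relation.Unary using (Decidable)

private variable
  I K : Set
  m n k : ℕ

-- Finite sums and the first-moment method

⟦_⟧ : Bool → ℕ
⟦ true  ⟧ = 1
⟦ false ⟧ = 0

⟦b⟧≤1 : ∀ b → ⟦ b ⟧ ≤ 1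
⟦b⟧≤1 true  = ≤-refl
⟦b⟧≤1 false = z≤n

⟦⟧-mono : ∀ {a b} → (a ≡ true → b ≡ true) → ⟦ a ⟧ ≤ ⟦ b ⟧
⟦⟧-mono {false} _ = z≤n
⟦⟧-mono {true}  h rewrite h refl = ≤-refl

∑ ∏ : List I → (I → ℕ) → ℕ
∑ xs f = sum (map f xs)
∏ xs f = product (map f xs)

infix 10 ∑ ∏
syntax ∑ xs (λ x → e) = ∑[ x ∈ xs ] e
syntax ∏ xs (λ x → e) = ∏[ x ∈ xs ] e

∑-cong : ∀ (xs : List I) {f g : I → ℕ} → (∀ x → f x ≡ g x) → ∑ xs f ≡ ∑ xs g
∑-cong xs h = cong sum (Listₚ.map-cong h xs)

∏-cong : ∀ (xs : List I) {f g : I → ℕ} → (∀ x → f x ≡ g x) → ∏ xs f ≡ ∏ xs g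
∏-cong xs h = cong product (Listₚ.map-cong h xs)

∑-mono-∈ : ∀ (xs : List I) {f g : I → ℕ} → (∀ {x} → x List.∈ xs → f x ≤ g x) → ∑ xs f ≤ ∑ xs g
∑-mono-∈ []       h = z≤n
∑-mono-∈ (x ∷ xs) h = +-mono-≤ (h (here refl)) (∑-mono-∈ xs (h ∘ there))

∑-mono : ∀ (xs : List I) {f g : I → ℕ} → (∀ x → f x ≤ g x) → ∑ xs f ≤ ∑ xs g
∑-mono xs h = ∑-mono-∈ xs (λ {x} _ → h x)

∏-mono : ∀ (xs : List I) {f g : I → ℕ} → (∀ x → f x ≤ g x) → ∏ xs f ≤ ∏ xs g
∏-mono []       h = ≤-refl
∏-mono (x ∷ xs) h = *-mono-≤ (h x) (∏-mono xs h)

∑-+ : ∀ (xs : List I) (f g : I → ℕ) → ∑[ x ∈ xs ] (f x + g x) ≡ ∑ xs f + ∑ xs g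
∑-+ []       f g = refl
∑-+ (x ∷ xs) f g rewrite ∑-+ xs f g = eq (f x) (g x) (∑ xs f) (∑ xs g)
  where
  eq : ∀ a b c d → a + b + (c + d) ≡ a + c + (b + d)
  eq = solve-∀

∏-* : ∀ (xs : List I) (f g : I → ℕ) → ∏[ x ∈ xs ] (f x * g x) ≡ ∏ xs f * ∏ xs g
∏-* []       f g = refl
∏-* (x ∷ xs) f g rewrite ∏-* xs f g = eq (f x) (g x) (∏ xs f) (∏ xs g)
  where
  eq : ∀ a b c d → a * b * (c * d) ≡ a * c * (b * d)
  eq = solve-∀

∑-*ˡ : ∀ (xs : List I) (f : I → ℕ) c → ∑[ x ∈ xs ] (c * f x) ≡ c * ∑ xs f
∑-*ˡ []       f c = sym (*-zeroʳ c)
∑-*ˡ (x ∷ xs) f c rewrite ∑-*ˡ xs f c = sym (*-distribˡ-+ c (f x) (∑ xs f))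

∑-*ʳ : ∀ (xs : List I) (f : I → ℕ) c → ∑[ x ∈ xs ] (f x * c) ≡ ∑ xs f * c
∑-*ʳ xs f c = trans (∑-cong xs (λ x → *-comm (f x) c)) (trans (∑-*ˡ xs f c) (*-comm c _))

∑-const : ∀ (xs : List I) c → ∑[ _ ∈ xs ] c ≡ length xs * c
∑-const []       c = refl
∑-const (x ∷ xs) c = cong (c +_) (∑-const xs c)

∏-const : ∀ (xs : List I) c → ∏[ _ ∈ xs ] c ≡ c ^ length xs
∏-const []       c = refl
∏-const (x ∷ xs) c = cong (c *_) (∏-const xs c)

^-∑ : ∀ (xs : List I) (f : I → ℕ) c → c ^ ∑ xs f ≡ ∏[ x ∈ xs ] (c ^ f x)
^-∑ []       f c = refl
^-∑ (x ∷ xs) f c = trans (^-distribˡ-+-* c (f x) (∑ xs f)) (cong (c ^ f x *_) (^-∑ xs f c))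

∑-++ : ∀ (xs ys : List I) (f : I → ℕ) → ∑ (xs ++ ys) f ≡ ∑ xs f + ∑ ys f
∑-++ []       ys f = refl
∑-++ (x ∷ xs) ys f rewrite ∑-++ xs ys f = sym (+-assoc (f x) _ _)

∑-map : ∀ (xs : List I) (h : I → K) (f : K → ℕ) → ∑ (map h xs) f ≡ ∑ xs (f ∘ h)
∑-map xs h f = cong sum (sym (Listₚ.map-∘ xs))

∑-swap : ∀ (xs : List I) (ys : List K) (f : I → K → ℕ) →
  ∑[ x ∈ xs ] ∑[ y ∈ ys ] f x y ≡ ∑[ y ∈ ys ] ∑[ x ∈ xs ] f x y
∑-swap []       ys f = sym (trans (∑-const ys 0) (*-zeroʳ (length ys)))
∑-swap (x ∷ xs) ys f rewrite ∑-swap xs ys f = sym (∑-+ ys (f x) _)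

∑-* : ∀ (xs : List I) (ys : List K) (f : I → ℕ) (g : K → ℕ) →
  ∑[ x ∈ xs ] ∑[ y ∈ ys ] (f x * g y) ≡ ∑ xs f * ∑ ys g
∑-* xs ys f g = trans (∑-cong xs (λ x → ∑-*ˡ ys g (f x))) (∑-*ʳ xs f (∑ ys g))

term≤∑ : ∀ {xs : List I} (f : I → ℕ) {x} → x List.∈ xs → f x ≤ ∑ xs f
term≤∑ f (here refl) = m≤m+n _ _
term≤∑ f (there x∈)  = ≤-trans (term≤∑ f x∈) (m≤n+m _ _)

∑<⇒∃ : ∀ (xs : List I) (f : I → ℕ) θ → ∑ xs f < length xs * θ → ∃ λ x → f x < θ
∑<⇒∃ (x ∷ xs) f θ h with f x <? θ
... | yes p = x , p
... | no ¬p = ∑<⇒∃ xs f θ (+-cancelˡ-< θ _ _ (≤-<-trans (+-monoˡ-≤ _ (≮⇒≥ ¬p)) h))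

∑⟦⟧>0⇒∃ : ∀ (xs : List I) (p : I → Bool) → 0 < ∑[ x ∈ xs ] ⟦ p x ⟧ → ∃ λ x → p x ≡ true
∑⟦⟧>0⇒∃ (x ∷ xs) p h with p x in eq
... | true  = x , eq
... | false = ∑⟦⟧>0⇒∃ xs p h

length-filter≡∑ : ∀ {P : I → Set} (P? : Decidable P) xs → length (filter P? xs) ≡ ∑[ x ∈ xs ] ⟦ does (P? x) ⟧
length-filter≡∑ P? [] = refl
length-filter≡∑ P? (x ∷ xs) with does (P? x)
... | true  = cong suc (length-filter≡∑ P? xs)
... | false = length-filter≡∑ P? xs

-- The first-moment method: each of the events l fails only where Φ l ω reaches
-- the threshold θ, and the Φ l together are too small on average.
union-bound : ∀ (Ω : List I) (ls : List K) (Φ : K → I → ℕ) u b θ →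
  (∀ {l} → l List.∈ ls → ∑ Ω (Φ l) * u ≤ b) → length ls * b < length Ω * θ * u →
  ∃ λ ω → ∀ {l} → l List.∈ ls → Φ l ω < θ
union-bound Ω ls Φ u b θ bound h =
  let ω , small = ∑<⇒∃ Ω (λ ω → ∑[ l ∈ ls ] Φ l ω) θ (*-cancelʳ-< _ _ _ total)
  in  ω , λ l∈ → ≤-<-trans (term≤∑ (λ l → Φ l ω) l∈) small
  where
  open ≤-Reasoning
  total : (∑[ ω ∈ Ω ] ∑[ l ∈ ls ] Φ l ω) * u < length Ω * θ * u
  total = begin-strict
    (∑[ ω ∈ Ω ] ∑[ l ∈ ls ] Φ l ω) * u  ≡⟨ cong (_* u) (∑-swap Ω ls (λ ω l → Φ l ω)) ⟩
    (∑[ l ∈ ls ] ∑ Ω (Φ l)) * u         ≡⟨ ∑-*ʳ ls (λ l → ∑ Ω (Φ l)) u ⟨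
    ∑[ l ∈ ls ] (∑ Ω (Φ l) * u)         ≤⟨ ∑-mono-∈ ls bound ⟩
    ∑[ _ ∈ ls ] b                       ≡⟨ ∑-const ls b ⟩
    length ls * b                       <⟨ h ⟩
    length Ω * θ * u                    ∎

∑-allFin-suc : ∀ (f : Fin (suc n) → ℕ) → ∑ (allFin (suc n)) f ≡ f zero + ∑ (allFin n) (f ∘ suc)
∑-allFin-suc f = cong (λ l → f zero + sum l)
  (trans (Listₚ.map-tabulate suc f) (sym (Listₚ.map-tabulate id (f ∘ suc))))

∏-allFin-suc : ∀ (f : Fin (suc n) → ℕ) → ∏ (allFin (suc n)) f ≡ f zero * ∏ (allFin n) (f ∘ suc)
∏-allFin-suc f = cong (λ l → f zero * product l)
  (trans (Listₚ.map-tabulate suc f) (sym (Listₚ.map-tabulate id (f ∘ suc))))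

∑-allFin-const : ∀ n c → ∑[ _ ∈ allFin n ] c ≡ n * c
∑-allFin-const n c = trans (∑-const (allFin n) c) (cong (_* c) (Listₚ.length-tabulate {n = n} id))

∏-allFin-const : ∀ n c → ∏[ _ ∈ allFin n ] c ≡ c ^ n
∏-allFin-const n c = trans (∏-const (allFin n) c) (cong (c ^_) (Listₚ.length-tabulate {n = n} id))

# : (Fin n → Bool) → ℕ
# p = ∑[ i ∈ allFin _ ] ⟦ p i ⟧

#-mono : ∀ {p q : Fin n → Bool} → (∀ i → p i ≡ true → q i ≡ true) → # p ≤ # q
#-mono h = ∑-mono (allFin _) (λ i → ⟦⟧-mono (h i))

#≤n : ∀ (p : Fin n → Bool) → # p ≤ n
#≤n {n} p = subst (# p ≤_) (trans (∑-allFin-const n 1) (*-identityʳ n)) (∑-mono (allFin n) (⟦b⟧≤1 ∘ p))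

∣S∣≡# : ∀ (S : Subset n) → ∣ S ∣ ≡ # (lookup S)
∣S∣≡# []          = refl
∣S∣≡# (true  ∷ S) = trans (cong suc (∣S∣≡# S)) (sym (∑-allFin-suc (⟦_⟧ ∘ lookup (true ∷ S))))
∣S∣≡# (false ∷ S) = trans (∣S∣≡# S) (sym (∑-allFin-suc (⟦_⟧ ∘ lookup (false ∷ S))))

∑-≟ : ∀ (i : Fin n) → # (λ j → does (i Finₚ.≟ j)) ≡ 1
∑-≟ {suc n} zero = trans (∑-allFin-suc {n} (λ j → ⟦ does (zero Finₚ.≟ j) ⟧))
  (cong suc (trans (∑-allFin-const n 0) (*-zeroʳ n)))
∑-≟ (suc i) = trans (∑-allFin-suc (λ j → ⟦ does (suc i Finₚ.≟ j) ⟧)) (trans (∑-cong (allFin _) same) (∑-≟ i))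
  where
  same : ∀ j → ⟦ does (suc i Finₚ.≟ suc j) ⟧ ≡ ⟦ does (i Finₚ.≟ j) ⟧
  same j with i Finₚ.≟ j
  ... | yes _ = refl
  ... | no  _ = refl

vectors : List I → ∀ n → List (Vec I n)
vectors xs zero    = [] ∷ []
vectors xs (suc n) = cartesianProductWith _∷_ xs (vectors xs n)

∈-vectors : ∀ {xs : List I} → (∀ x → x List.∈ xs) → (v : Vec I n) → v List.∈ vectors xs n
∈-vectors all []      = here refl
∈-vectors all (x ∷ v) = ∈-cartesianProductWith⁺ _∷_ (all x) (∈-vectors all v)

∑-cartesianProductWith : ∀ {Z : Set} (h : I → K → Z) xs ys (f : Z → ℕ) →
  ∑ (cartesianProductWith h xs ys) f ≡ ∑[ x ∈ xs ] ∑[ y ∈ ys ] f (h x y)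
∑-cartesianProductWith h []       ys f = refl
∑-cartesianProductWith h (x ∷ xs) ys f = trans (∑-++ (map (h x) ys) _ f)
  (cong₂ _+_ (∑-map ys (h x) f) (∑-cartesianProductWith h xs ys f))

length-cartesianProductWith : ∀ {Z : Set} (h : I → K → Z) xs ys →
  length (cartesianProductWith h xs ys) ≡ length xs * length ys
length-cartesianProductWith h []       ys = refl
length-cartesianProductWith h (x ∷ xs) ys = trans (Listₚ.length-++ (map (h x) ys))
  (cong₂ _+_ (Listₚ.length-map (h x) ys) (length-cartesianProductWith h xs ys))

length-vectors : ∀ (xs : List I) n → length (vectors xs n) ≡ length xs ^ n
length-vectors xs zero    = refl
length-vectors xs (suc n) = trans (length-cartesianProductWith _∷_ xs _) (cong (length xs *_) (length-vectors xs n))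

-- Independence of the coordinates of a uniformly random vector.
∑-∏ : ∀ (xs : List I) n (φ : Fin n → I → ℕ) →
  ∑[ v ∈ vectors xs n ] ∏[ i ∈ allFin n ] φ i (lookup v i) ≡ ∏[ i ∈ allFin n ] ∑ xs (φ i)
∑-∏ xs zero    φ = refl
∑-∏ xs (suc n) φ = begin
  ∑[ v ∈ vectors xs (suc n) ] ∏[ i ∈ allFin (suc n) ] φ i (lookup v i)
    ≡⟨ ∑-cartesianProductWith _∷_ xs (vectors xs n) _ ⟩
  ∑[ x ∈ xs ] ∑[ v ∈ vectors xs n ] ∏[ i ∈ allFin (suc n) ] φ i (lookup (x ∷ v) i)
    ≡⟨ ∑-cong xs (λ x → ∑-cong (vectors xs n) (λ v → ∏-allFin-suc (λ i → φ i (lookup (x ∷ v) i)))) ⟩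
  ∑[ x ∈ xs ] ∑[ v ∈ vectors xs n ] (φ zero x * ∏[ i ∈ allFin n ] φ (suc i) (lookup v i))
    ≡⟨ ∑-* xs (vectors xs n) (φ zero) _ ⟩
  ∑ xs (φ zero) * ∑[ v ∈ vectors xs n ] ∏[ i ∈ allFin n ] φ (suc i) (lookup v i)
    ≡⟨ cong (∑ xs (φ zero) *_) (∑-∏ xs n (φ ∘ suc)) ⟩
  ∑ xs (φ zero) * ∏[ i ∈ allFin n ] ∑ xs (φ (suc i))
    ≡⟨ ∏-allFin-suc (λ i → ∑ xs (φ i)) ⟨
  ∏[ i ∈ allFin (suc n) ] ∑ xs (φ i) ∎
  where open ≡-Reasoning

-- An inequality is derived from S ≤ T by exhibiting it, multiplied by suc m,
-- as S ≤ T up to a nonnegative slack; the identity is left to the ring solver.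
linear : ∀ m slack {a b L R} → a ≤ b → suc m * L + b + slack ≡ suc m * R + a → L ≤ R
linear m slack {a} {b} {L} {R} a≤b eq = *-cancelˡ-≤ (suc m) (+-cancelʳ-≤ a _ _ (begin
  suc m * L + a           ≤⟨ +-monoʳ-≤ (suc m * L) a≤b ⟩
  suc m * L + b           ≤⟨ m≤m+n _ slack ⟩
  suc m * L + b + slack   ≡⟨ eq ⟩
  suc m * R + a           ∎))
  where open ≤-Reasoning

^-distribʳ-* : ∀ a b e → (a * b) ^ e ≡ a ^ e * b ^ e
^-distribʳ-* a b zero    = refl
^-distribʳ-* a b (suc e) rewrite ^-distribʳ-* a b e = eq a b (a ^ e) (b ^ e)
  where
  eq : ∀ w x y z → w * x * (y * z) ≡ w * y * (x * z)
  eq = solve-∀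

^-cancelʳ-< : ∀ a {i j} → suc a ^ i < suc a ^ j → i < j
^-cancelʳ-< a {i} {j} h with i <? j
... | yes p = p
... | no ¬p = contradiction h (≤⇒≯ (^-monoʳ-≤ (suc a) (≮⇒≥ ¬p)))

-- Random tournaments

subsetsOfSize : ∀ k (t : ℕ) → List (Subset k)
subsetsOfSize zero    zero    = [] ∷ []
subsetsOfSize zero    (suc t) = []
subsetsOfSize (suc k) zero    = map (outside ∷_) (subsetsOfSize k zero)
subsetsOfSize (suc k) (suc t) =
  map (inside ∷_) (subsetsOfSize k t) ++ map (outside ∷_) (subsetsOfSize k (suc t))

∈-subsetsOfSize : ∀ (S : Subset k) (t : ℕ) → ∣ S ∣ ≡ t → S List.∈ subsetsOfSize k t
∈-subsetsOfSize []          zero    h = here refl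
∈-subsetsOfSize (true  ∷ S) (suc t) h = ∈-++⁺ˡ (∈-map⁺ (inside ∷_) (∈-subsetsOfSize S t (suc-injective h)))
∈-subsetsOfSize (false ∷ S) zero    h = ∈-map⁺ (outside ∷_) (∈-subsetsOfSize S zero h)
∈-subsetsOfSize {suc k} (false ∷ S) (suc t) h =
  ∈-++⁺ʳ (map (inside ∷_) (subsetsOfSize k t)) (∈-map⁺ (outside ∷_) (∈-subsetsOfSize S (suc t) h))

∈-subsetsOfSize⁻ : ∀ k (t : ℕ) {S} → S List.∈ subsetsOfSize k t → ∣ S ∣ ≡ t
∈-subsetsOfSize⁻ zero    zero    (here refl) = refl
∈-subsetsOfSize⁻ (suc k) zero    S∈ with ∈-map⁻ (outside ∷_) S∈
... | _ , S∈ , refl = ∈-subsetsOfSize⁻ k zero S∈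
∈-subsetsOfSize⁻ (suc k) (suc t) S∈ with ∈-++⁻ (map (inside ∷_) (subsetsOfSize k t)) S∈
... | inj₁ S∈ˡ with ∈-map⁻ (inside ∷_) S∈ˡ
...   | _ , S∈ , refl = cong suc (∈-subsetsOfSize⁻ k t S∈)
∈-subsetsOfSize⁻ (suc k) (suc t) S∈ | inj₂ S∈ʳ with ∈-map⁻ (outside ∷_) S∈ʳ
...   | _ , S∈ , refl = ∈-subsetsOfSize⁻ k (suc t) S∈

length-subsetsOfSize : ∀ k (t : ℕ) → length (subsetsOfSize k t) ≤ k ^ t
length-subsetsOfSize zero    zero    = ≤-refl
length-subsetsOfSize zero    (suc t) = z≤n
length-subsetsOfSize (suc k) zero    =
  ≤-trans (≤-reflexive (Listₚ.length-map _ (subsetsOfSize k zero))) (length-subsetsOfSize k zero)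
length-subsetsOfSize (suc k) (suc t) = begin
  length (subsetsOfSize (suc k) (suc t))
    ≡⟨ Listₚ.length-++ (map (inside ∷_) (subsetsOfSize k t)) ⟩
  length (map (inside ∷_) (subsetsOfSize k t)) + length (map (outside ∷_) (subsetsOfSize k (suc t)))
    ≡⟨ cong₂ _+_ (Listₚ.length-map _ (subsetsOfSize k t)) (Listₚ.length-map _ (subsetsOfSize k (suc t))) ⟩
  length (subsetsOfSize k t) + length (subsetsOfSize k (suc t))
    ≤⟨ +-mono-≤ (length-subsetsOfSize k t) (length-subsetsOfSize k (suc t)) ⟩
  k ^ t + k * k ^ t
    ≤⟨ *-monoʳ-≤ (suc k) (^-monoˡ-≤ t (n≤1+n k)) ⟩
  suc k * suc k ^ t ∎
  where open ≤-Reasoning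

_≺_ : Fin k → Fin k → Bool
p ≺ r = toℕ p <ᵇ toℕ r

≺⇒< : ∀ (p r : Fin k) → p ≺ r ≡ true → toℕ p < toℕ r
≺⇒< p r h = <ᵇ⇒< (toℕ p) (toℕ r) (subst T (sym h) _)

⊀⇒≥ : ∀ (p r : Fin k) → p ≺ r ≡ false → toℕ r ≤ toℕ p
⊀⇒≥ p r h = ≮⇒≥ (λ p<r → subst T h (<⇒<ᵇ p<r))

≺-asym : ∀ (p r : Fin k) {A : Set} → p ≺ r ≡ true → r ≺ p ≡ true → A
≺-asym p r p≺r r≺p = contradiction (≺⇒< p r p≺r) (<-asym (≺⇒< r p r≺p))

orient : (Fin k → Fin k → Bool) → Fin k → Fin k → Bool
orient ω p r = if p ≺ r then ω p r else (if r ≺ p then not (ω r p) else false)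

orient-antisym : ∀ (ω : Fin k → Fin k → Bool) {p r} → p ≢ r → orient ω r p ≡ not (orient ω p r)
orient-antisym ω {p} {r} p≢r with p ≺ r in p≺r | r ≺ p in r≺p
... | true  | true  = ≺-asym p r p≺r r≺p
... | true  | false = refl
... | false | true  with ω r p
...   | true  = refl
...   | false = refl
orient-antisym ω {p} {r} p≢r | false | false =
  contradiction (Finₚ.toℕ-injective (≤-antisym (⊀⇒≥ r p r≺p) (⊀⇒≥ p r p≺r))) p≢r

edges : (Fin k → Fin k → Bool) → Subset k → Subset k → ℕ
edges {k} T X Y = ∑[ p ∈ allFin k ] ∑[ r ∈ allFin k ] ⟦ lookup X p ∧ (lookup Y r ∧ T p r) ⟧

-- The contribution of the unordered pair p < r to edges (orient ω) X Y when ω p r = b.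
cell : Subset k → Subset k → Fin k → Fin k → Bool → ℕ
cell X Y p r b = if p ≺ r
  then ⟦ lookup X p ∧ (lookup Y r ∧ b) ⟧ + ⟦ lookup X r ∧ (lookup Y p ∧ not b) ⟧ else 0

edges-orient : ∀ (ω : Fin k → Fin k → Bool) X Y →
  edges (orient ω) X Y ≡ ∑[ p ∈ allFin k ] ∑[ r ∈ allFin k ] cell X Y p r (ω p r)
edges-orient {k} ω X Y = begin
  ∑[ p ∈ all ] ∑[ r ∈ all ] ε p r
    ≡⟨ ∑-cong all (λ p → trans (∑-cong all (split p)) (∑-+ all _ _)) ⟩
  ∑[ p ∈ all ] (∑[ r ∈ all ] up p r + ∑[ r ∈ all ] down p r)
    ≡⟨ ∑-+ all _ _ ⟩
  (∑[ p ∈ all ] ∑[ r ∈ all ] up p r) + (∑[ p ∈ all ] ∑[ r ∈ all ] down p r)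
    ≡⟨ cong ((∑[ p ∈ all ] ∑[ r ∈ all ] up p r) +_) (∑-swap all all down) ⟩
  (∑[ p ∈ all ] ∑[ r ∈ all ] up p r) + (∑[ p ∈ all ] ∑[ r ∈ all ] down r p)
    ≡⟨ ∑-+ all _ _ ⟨
  ∑[ p ∈ all ] (∑[ r ∈ all ] up p r + ∑[ r ∈ all ] down r p)
    ≡⟨ ∑-cong all (λ p → trans (sym (∑-+ all _ _)) (∑-cong all (merge p))) ⟩
  ∑[ p ∈ all ] ∑[ r ∈ all ] cell X Y p r (ω p r) ∎
  where
  open ≡-Reasoning
  all = allFin k
  ε up down : Fin k → Fin k → ℕ
  ε p r    = ⟦ lookup X p ∧ (lookup Y r ∧ orient ω p r) ⟧
  up p r   = if p ≺ r then ⟦ lookup X p ∧ (lookup Y r ∧ ω p r) ⟧ else 0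
  down p r = if r ≺ p then ⟦ lookup X p ∧ (lookup Y r ∧ not (ω r p)) ⟧ else 0
  split : ∀ p r → ε p r ≡ up p r + down p r
  split p r with p ≺ r in p≺r | r ≺ p in r≺p
  ... | true | true = ≺-asym p r p≺r r≺p
  ... | true | false   = sym (+-identityʳ _)
  ... | false | true  = refl
  ... | false | false with lookup X p | lookup Y r
  ...   | true  | true  = refl
  ...   | true  | false = refl
  ...   | false | _     = refl
  merge : ∀ p r → up p r + down r p ≡ cell X Y p r (ω p r)
  merge p r with p ≺ r
  ... | true = refl
  ... | false = refl

cells : Subset k → Subset k → Fin k → Fin k → ℕ
cells X Y p r = if p ≺ r
  then ⟦ lookup X p ⟧ * ⟦ lookup Y r ⟧ + ⟦ lookup X r ⟧ * ⟦ lookup Y p ⟧ else 0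

∑-cells≤ : ∀ (X Y : Subset k) → ∑[ p ∈ allFin k ] ∑[ r ∈ allFin k ] cells X Y p r ≤ ∣ X ∣ * ∣ Y ∣
∑-cells≤ {k} X Y = begin
  ∑[ p ∈ all ] ∑[ r ∈ all ] cells X Y p r
    ≡⟨ ∑-cong all (λ p → trans (∑-cong all (split p)) (∑-+ all _ _)) ⟩
  ∑[ p ∈ all ] (∑[ r ∈ all ] up p r + ∑[ r ∈ all ] down r p)
    ≡⟨ ∑-+ all _ _ ⟩
  (∑[ p ∈ all ] ∑[ r ∈ all ] up p r) + (∑[ p ∈ all ] ∑[ r ∈ all ] down r p)
    ≡⟨ cong ((∑[ p ∈ all ] ∑[ r ∈ all ] up p r) +_) (∑-swap all all (λ p r → down r p)) ⟩
  (∑[ p ∈ all ] ∑[ r ∈ all ] up p r) + (∑[ p ∈ all ] ∑[ r ∈ all ] down p r)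
    ≡⟨ ∑-+ all _ _ ⟨
  ∑[ p ∈ all ] (∑[ r ∈ all ] up p r + ∑[ r ∈ all ] down p r)
    ≤⟨ ∑-mono all (λ p → ≤-trans (≤-reflexive (sym (∑-+ all _ _))) (∑-mono all (merge p))) ⟩
  ∑[ p ∈ all ] ∑[ r ∈ all ] (⟦ lookup X p ⟧ * ⟦ lookup Y r ⟧)
    ≡⟨ ∑-* all all _ _ ⟩
  # (lookup X) * # (lookup Y)
    ≡⟨ cong₂ _*_ (∣S∣≡# X) (∣S∣≡# Y) ⟨
  ∣ X ∣ * ∣ Y ∣ ∎
  where
  open ≤-Reasoning
  all = allFin k
  up down : Fin k → Fin k → ℕ
  up p r   = if p ≺ r then ⟦ lookup X p ⟧ * ⟦ lookup Y r ⟧ else 0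
  down p r = if r ≺ p then ⟦ lookup X p ⟧ * ⟦ lookup Y r ⟧ else 0
  split : ∀ p r → cells X Y p r ≡ up p r + down r p
  split p r with p ≺ r
  ... | true = refl
  ... | false = refl
  merge : ∀ p r → up p r + down p r ≤ ⟦ lookup X p ⟧ * ⟦ lookup Y r ⟧
  merge p r with p ≺ r in p≺r | r ≺ p in r≺p
  ... | true | true = ≺-asym p r p≺r r≺p
  ... | true | false   = ≤-reflexive (+-identityʳ _)
  ... | false | true  = ≤-refl
  ... | false | false   = z≤n

bits : List Bool
bits = false ∷ true ∷ []

cell-moment : ∀ (X Y : Subset k) p r →
  ∑[ b ∈ bits ] (4 ^ cell X Y p r b) * 2 ^ cells X Y p r ≤ 2 * 5 ^ cells X Y p r
cell-moment X Y p r with p ≺ r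
... | false = ≤-refl
... | true with lookup X p | lookup Y r | lookup X r | lookup Y p
...   | true  | true  | true  | true  = toWitness {a? = _ ≤? _} _
...   | true  | true  | true  | false = toWitness {a? = _ ≤? _} _
...   | true  | true  | false | _     = toWitness {a? = _ ≤? _} _
...   | true  | false | true  | true  = toWitness {a? = _ ≤? _} _
...   | true  | false | true  | false = toWitness {a? = _ ≤? _} _
...   | true  | false | false | _     = toWitness {a? = _ ≤? _} _
...   | false | _     | true  | true  = toWitness {a? = _ ≤? _} _
...   | false | _     | true  | false = toWitness {a? = _ ≤? _} _
...   | false | _     | false | _     = toWitness {a? = _ ≤? _} _

matrices : ∀ k → List (Vec (Vec Bool k) k)
matrices k = vectors (vectors bits k) k

entry : Vec (Vec I n) m → Fin m → Fin n → I
entry v p r = lookup (lookup v p) r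

scale-^ : ∀ x c {s t} → x * 2 ^ s ≤ c * 5 ^ s → s ≤ t → x * 2 ^ t ≤ c * 5 ^ t
scale-^ x c {s} {t} h s≤t with t ∸ s | m+[n∸m]≡n s≤t
... | d | refl = begin
  x * 2 ^ (s + d)     ≡⟨ cong (x *_) (^-distribˡ-+-* 2 s d) ⟩
  x * (2 ^ s * 2 ^ d) ≡⟨ *-assoc x _ _ ⟨
  x * 2 ^ s * 2 ^ d   ≤⟨ *-mono-≤ h (^-monoˡ-≤ d (toWitness {a? = 2 ≤? 5} _)) ⟩
  c * 5 ^ s * 5 ^ d   ≡⟨ *-assoc c _ _ ⟩
  c * (5 ^ s * 5 ^ d) ≡⟨ cong (c *_) (^-distribˡ-+-* 5 s d) ⟨
  c * 5 ^ (s + d)     ∎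
  where open ≤-Reasoning

edges-moment : ∀ (X Y : Subset k) →
  ∑[ ω ∈ matrices k ] (4 ^ edges (orient (entry ω)) X Y) * 2 ^ (∣ X ∣ * ∣ Y ∣) ≤ (2 ^ k) ^ k * 5 ^ (∣ X ∣ * ∣ Y ∣)
edges-moment {k} X Y = scale-^ (∑[ ω ∈ matrices k ] (4 ^ edges (orient (entry ω)) X Y)) ((2 ^ k) ^ k) (begin
  ∑[ ω ∈ matrices k ] (4 ^ edges (orient (entry ω)) X Y) * 2 ^ ∑∑cells
    ≡⟨ cong₂ _*_ moment (pow∑∑ 2) ⟩
  (∏[ p ∈ all ] ∏[ r ∈ all ] ∑[ b ∈ bits ] (4 ^ cell X Y p r b)) * ∏[ p ∈ all ] ∏[ r ∈ all ] (2 ^ cells X Y p r)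
    ≡⟨ ∏∏-* (λ p r → ∑[ b ∈ bits ] (4 ^ cell X Y p r b)) (λ p r → 2 ^ cells X Y p r) ⟨
  ∏[ p ∈ all ] ∏[ r ∈ all ] (∑[ b ∈ bits ] (4 ^ cell X Y p r b) * 2 ^ cells X Y p r)
    ≤⟨ ∏-mono all (λ p → ∏-mono all (cell-moment X Y p)) ⟩
  ∏[ p ∈ all ] ∏[ r ∈ all ] (2 * 5 ^ cells X Y p r)
    ≡⟨ ∏∏-* (λ _ _ → 2) (λ p r → 5 ^ cells X Y p r) ⟩
  (∏[ p ∈ all ] ∏[ r ∈ all ] 2) * ∏[ p ∈ all ] ∏[ r ∈ all ] (5 ^ cells X Y p r)
    ≡⟨ cong₂ _*_ (trans (∏-cong all (λ _ → ∏-allFin-const k 2)) (∏-allFin-const k (2 ^ k))) (sym (pow∑∑ 5)) ⟩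
  (2 ^ k) ^ k * 5 ^ ∑∑cells ∎)
  (∑-cells≤ X Y)
  where
  open ≤-Reasoning
  all = allFin k
  ∑∑cells = ∑[ p ∈ all ] ∑[ r ∈ all ] cells X Y p r
  ∏∏-* : ∀ (f g : Fin k → Fin k → ℕ) →
    ∏[ p ∈ all ] ∏[ r ∈ all ] (f p r * g p r) ≡ (∏[ p ∈ all ] ∏[ r ∈ all ] f p r) * ∏[ p ∈ all ] ∏[ r ∈ all ] g p r
  ∏∏-* f g = trans (∏-cong all (λ p → ∏-* all (f p) (g p))) (∏-* all _ _)
  pow∑∑′ : ∀ c (f : Fin k → Fin k → ℕ) → c ^ (∑[ p ∈ all ] ∑[ r ∈ all ] f p r) ≡ ∏[ p ∈ all ] ∏[ r ∈ all ] (c ^ f p r)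
  pow∑∑′ c f = trans (^-∑ all _ c) (∏-cong all (λ p → ^-∑ all (f p) c))
  pow∑∑ : ∀ c → c ^ ∑∑cells ≡ ∏[ p ∈ all ] ∏[ r ∈ all ] (c ^ cells X Y p r)
  pow∑∑ c = pow∑∑′ c (cells X Y)
  moment : ∑[ ω ∈ matrices k ] (4 ^ edges (orient (entry ω)) X Y)
         ≡ ∏[ p ∈ all ] ∏[ r ∈ all ] ∑[ b ∈ bits ] (4 ^ cell X Y p r b)
  moment = trans
    (∑-cong (matrices k) (λ ω → trans (cong (4 ^_) (edges-orient (entry ω) X Y))
                                      (pow∑∑′ 4 (λ p r → cell X Y p r (entry ω p r)))))
    (trans (∑-∏ (vectors bits k) k (λ p v → ∏[ r ∈ all ] (4 ^ cell X Y p r (lookup v r))))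
           (∏-cong all (λ p → ∑-∏ bits k (λ r b → 4 ^ cell X Y p r b))))

edges-reflexive-closure : ∀ (T : Fin k → Fin k → Bool) X Y →
  edges (λ p r → T p r ∨ does (p Finₚ.≟ r)) X Y ≤ edges T X Y + ∣ X ∣
edges-reflexive-closure {k} T X Y = begin
  edges (λ p r → T p r ∨ does (p Finₚ.≟ r)) X Y
    ≤⟨ ∑-mono all (λ p → ∑-mono all (split p)) ⟩
  ∑[ p ∈ all ] ∑[ r ∈ all ] (⟦ lookup X p ∧ (lookup Y r ∧ T p r) ⟧ + ⟦ lookup X p ⟧ * ⟦ does (p Finₚ.≟ r) ⟧)
    ≡⟨ trans (∑-cong all (λ p → ∑-+ all _ _)) (∑-+ all _ _) ⟩
  edges T X Y + ∑[ p ∈ all ] ∑[ r ∈ all ] (⟦ lookup X p ⟧ * ⟦ does (p Finₚ.≟ r) ⟧)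
    ≡⟨ cong (edges T X Y +_) (∑-cong all diag) ⟩
  edges T X Y + # (lookup X)
    ≡⟨ cong (edges T X Y +_) (∣S∣≡# X) ⟨
  edges T X Y + ∣ X ∣ ∎
  where
  open ≤-Reasoning
  all = allFin k
  split : ∀ p r → ⟦ lookup X p ∧ (lookup Y r ∧ (T p r ∨ does (p Finₚ.≟ r))) ⟧
                ≤ ⟦ lookup X p ∧ (lookup Y r ∧ T p r) ⟧ + ⟦ lookup X p ⟧ * ⟦ does (p Finₚ.≟ r) ⟧
  split p r with lookup X p | lookup Y r | T p r
  ... | false | _     | _     = z≤n
  ... | true  | false | _     = z≤n
  ... | true  | true  | true  = s≤s z≤n
  ... | true  | true  | false = ≤-reflexive (sym (+-identityʳ _))
  diag : ∀ p → ∑[ r ∈ all ] (⟦ lookup X p ⟧ * ⟦ does (p Finₚ.≟ r) ⟧) ≡ ⟦ lookup X p ⟧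
  diag p = trans (∑-*ˡ all (λ r → ⟦ does (p Finₚ.≟ r) ⟧) ⟦ lookup X p ⟧)
    (trans (cong (⟦ lookup X p ⟧ *_) (∑-≟ p)) (*-identityʳ _))

-- The expectation of 4^(edges from X to Y) is at most (5/2)^(t²) for t = 16q, which outweighs
-- the 4^(qt) choices of X and Y and bounds the number of edges by 3t²/4.
sparse-tournament : ∀ q → 2 ≤ q → k ≤ 2 ^ q →
  ∃ λ (T : Fin k → Fin k → Bool) → (∀ {p r} → p ≢ r → T r p ≡ not (T p r)) ×
    (∀ X Y → ∣ X ∣ ≡ q * 16 → ∣ Y ∣ ≡ q * 16 →
      edges (λ p r → T p r ∨ does (p Finₚ.≟ r)) X Y * 5 < q * 16 * (q * 16) * 4)
sparse-tournament {k} q 2≤q k≤2^q = orient (entry ω) , orient-antisym (entry ω) , sparse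
  where
  open ≤-Reasoning
  t = q * 16
  e = q * t
  sets = subsetsOfSize k t
  pairs = cartesianProduct sets sets
  Q = (2 ^ k) ^ k
  0<q : 0 < q
  0<q = <-≤-trans (s≤s z≤n) 2≤q
  0<e : 0 < e
  0<e = *-mono-< 0<q (*-mono-< 0<q (s≤s (z≤n {15})))
  instance
    e≢0 : NonZero e
    e≢0 = >-nonZero 0<e
    Q≢0 : NonZero Q
    Q≢0 = m^n≢0 (2 ^ k) k {{m^n≢0 2 k}}
  tt≡16e : t * t ≡ 16 * e
  tt≡16e = eq q
    where
    eq : ∀ q → q * 16 * (q * 16) ≡ 16 * (q * (q * 16))
    eq = solve-∀
  few : length sets ≤ 2 ^ e
  few = begin
    length sets  ≤⟨ length-subsetsOfSize k t ⟩
    k ^ t        ≤⟨ ^-monoˡ-≤ t k≤2^q ⟩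
    (2 ^ q) ^ t  ≡⟨ ^-*-assoc 2 q t ⟩
    2 ^ e        ∎
  Φ : Subset k × Subset k → Vec (Vec Bool k) k → ℕ
  Φ (X , Y) ω = 4 ^ edges (orient (entry ω)) X Y
  moment : ∀ {XY} → XY List.∈ pairs → ∑ (matrices k) (Φ XY) * 2 ^ (t * t) ≤ Q * 5 ^ (t * t)
  moment {X , Y} XY∈ with ∈-cartesianProduct⁻ sets sets XY∈
  ... | X∈ , Y∈ = subst₂
    (λ x y → ∑ (matrices k) (Φ (X , Y)) * 2 ^ (x * y) ≤ Q * 5 ^ (x * y))
    (∈-subsetsOfSize⁻ k t X∈) (∈-subsetsOfSize⁻ k t Y∈) (edges-moment X Y)
  average : length pairs * (Q * 5 ^ (t * t)) < length (matrices k) * 4 ^ (12 * e) * 2 ^ (t * t)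
  average = begin-strict
    length pairs * (Q * 5 ^ (t * t))
      ≡⟨ cong₂ (λ l x → l * (Q * 5 ^ x)) (length-cartesianProductWith _,_ sets sets) tt≡16e ⟩
    length sets * length sets * (Q * 5 ^ (16 * e))
      ≤⟨ *-monoˡ-≤ _ (*-mono-≤ few few) ⟩
    2 ^ e * 2 ^ e * (Q * 5 ^ (16 * e))
      ≡⟨ regroup (2 ^ e) Q (5 ^ (16 * e)) ⟩
    Q * (2 ^ e * 2 ^ e * 5 ^ (16 * e))
      ≡⟨ cong₂ (λ x y → Q * (x * y)) (sym (^-distribʳ-* 2 2 e)) (sym (^-*-assoc 5 16 e)) ⟩
    Q * ((2 * 2) ^ e * (5 ^ 16) ^ e)
      ≡⟨ cong (Q *_) (^-distribʳ-* (2 * 2) (5 ^ 16) e) ⟨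
    Q * (2 * 2 * 5 ^ 16) ^ e
      <⟨ *-monoʳ-< Q (^-monoˡ-< e (toWitness {a? = 2 * 2 * 5 ^ 16 <? 4 ^ 12 * 2 ^ 16} _)) ⟩
    Q * (4 ^ 12 * 2 ^ 16) ^ e
      ≡⟨ cong (Q *_) (^-distribʳ-* (4 ^ 12) (2 ^ 16) e) ⟩
    Q * ((4 ^ 12) ^ e * (2 ^ 16) ^ e)
      ≡⟨ cong₂ (λ x y → Q * (x * y)) (^-*-assoc 4 12 e) (^-*-assoc 2 16 e) ⟩
    Q * (4 ^ (12 * e) * 2 ^ (16 * e))
      ≡⟨ *-assoc Q _ _ ⟨
    Q * 4 ^ (12 * e) * 2 ^ (16 * e)
      ≡⟨ cong₂ (λ l x → l * 4 ^ (12 * e) * 2 ^ x) (sym size) (sym tt≡16e) ⟩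
    length (matrices k) * 4 ^ (12 * e) * 2 ^ (t * t) ∎
    where
    regroup : ∀ a b c → a * a * (b * c) ≡ b * (a * a * c)
    regroup = solve-∀
    size : length (matrices k) ≡ Q
    size = trans (length-vectors (vectors bits k) k) (cong (_^ k) (length-vectors bits k))
  good : ∃ λ ω → ∀ {XY} → XY List.∈ pairs → Φ XY ω < 4 ^ (12 * e)
  good = union-bound (matrices k) pairs Φ (2 ^ (t * t)) (Q * 5 ^ (t * t)) (4 ^ (12 * e)) moment average
  ω : Vec (Vec Bool k) k
  ω = proj₁ good
  sparse : ∀ X Y → ∣ X ∣ ≡ t → ∣ Y ∣ ≡ t → edges (λ p r → orient (entry ω) p r ∨ does (p Finₚ.≟ r)) X Y * 5 < t * t * 4
  sparse X Y ∣X∣≡t ∣Y∣≡t = begin-strict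
    edges (λ p r → orient (entry ω) p r ∨ does (p Finₚ.≟ r)) X Y * 5
      ≤⟨ *-monoˡ-≤ 5 (edges-reflexive-closure (orient (entry ω)) X Y) ⟩
    (edges (orient (entry ω)) X Y + ∣ X ∣) * 5
      <⟨ *-monoˡ-< 5 (+-mono-<-≤ {edges (orient (entry ω)) X Y} {12 * e}
           (^-cancelʳ-< 3 (proj₂ good (∈-cartesianProduct⁺ (∈-subsetsOfSize X t ∣X∣≡t) (∈-subsetsOfSize Y t ∣Y∣≡t))))
           (≤-reflexive ∣X∣≡t)) ⟩
    (12 * e + t) * 5
      ≤⟨ linear 0 (q * 48) (*-monoˡ-≤ (q * 64) 2≤q) (eq q) ⟩
    t * t * 4 ∎
    where
    eq : ∀ q → 1 * ((12 * (q * (q * 16)) + q * 16) * 5) + q * (q * 64) + q * 48 ≡ 1 * (q * 16 * (q * 16) * 4) + 2 * (q * 64)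
    eq = solve-∀

-- Random bipartite graphs

∏<1⇒∃ : ∀ (xs : List I) (f : I → ℕ) → ∏ xs f < 1 → ∃ λ x → f x < 1
∏<1⇒∃ []       f (s≤s ())
∏<1⇒∃ (x ∷ xs) f h with f x in eq
... | zero  = x , ≤-reflexive (cong suc eq)
... | suc y = ∏<1⇒∃ xs f (≤-<-trans (m≤m+n _ _) h)

⟦not⟧<1 : ∀ b → ⟦ not b ⟧ < 1 → b ≡ true
⟦not⟧<1 true  _ = refl
⟦not⟧<1 false (s≤s ())

#+#not : ∀ (p : Fin n → Bool) → # p + # (not ∘ p) ≡ n
#+#not {n} p = begin
  # p + # (not ∘ p)                              ≡⟨ ∑-+ (allFin n) _ _ ⟨
  ∑[ i ∈ allFin n ] (⟦ p i ⟧ + ⟦ not (p i) ⟧)    ≡⟨ ∑-cong (allFin n) (λ i → one (p i)) ⟩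
  ∑[ _ ∈ allFin n ] 1                            ≡⟨ ∑-allFin-const n 1 ⟩
  n * 1                                          ≡⟨ *-identityʳ n ⟩
  n ∎
  where
  open ≡-Reasoning
  one : ∀ b → ⟦ b ⟧ + ⟦ not b ⟧ ≡ 1
  one true  = refl
  one false = refl

module _ {κ : ℕ} (W : Fin κ → Fin κ → Bool) {n : ℕ} where

  forbidden : Vec (Fin κ) n → Vec (Fin κ) n → Fin n → Fin n → Bool
  forbidden f g a b = W (lookup f a) (lookup g b)

  heavy : Vec (Fin κ) n → Vec (Fin κ) n → Fin n → Bool
  heavy f g a = n ≤ᵇ # (forbidden f g a) * 200

  samples : ∀ d → List (Vec (Vec (Fin n) d) n)
  samples d = vectors (vectors (allFin n) d) n

  avoids : ∀ {d} → Vec (Fin κ) n × Vec (Fin κ) n → Vec (Vec (Fin n) d) n → ℕ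
  avoids {d} (f , g) ω = ∏[ a ∈ allFin n ] ∏[ i ∈ allFin d ] ⟦ not (forbidden f g a (entry ω a i)) ⟧

  ∑-avoids : ∀ d f g → ∑ (samples d) (avoids (f , g)) ≡ ∏[ a ∈ allFin n ] (# (not ∘ forbidden f g a) ^ d)
  ∑-avoids d f g = begin
    ∑ (samples d) (avoids (f , g))
      ≡⟨ ∑-∏ (vectors (allFin n) d) n (λ a v → ∏[ i ∈ allFin d ] ⟦ not (forbidden f g a (lookup v i)) ⟧) ⟩
    ∏[ a ∈ allFin n ] ∑[ v ∈ vectors (allFin n) d ] ∏[ i ∈ allFin d ] ⟦ not (forbidden f g a (lookup v i)) ⟧
      ≡⟨ ∏-cong (allFin n) (λ a → ∑-∏ (allFin n) d (λ i b → ⟦ not (forbidden f g a b) ⟧)) ⟩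
    ∏[ a ∈ allFin n ] ∏[ i ∈ allFin d ] # (not ∘ forbidden f g a)
      ≡⟨ ∏-cong (allFin n) (λ a → ∏-allFin-const d _) ⟩
    ∏[ a ∈ allFin n ] (# (not ∘ forbidden f g a) ^ d) ∎
    where open ≡-Reasoning

  heavy-factor : ∀ f g a → # (not ∘ forbidden f g a) * 200 ^ ⟦ heavy f g a ⟧ ≤ n * 199 ^ ⟦ heavy f g a ⟧
  heavy-factor f g a with heavy f g a in eq
  ... | false = *-monoˡ-≤ 1 (#≤n (not ∘ forbidden f g a))
  ... | true  = linear 0 0 (≤ᵇ⇒≤ n _ (subst T (sym eq) _)) (identity (# (forbidden f g a)) (# (not ∘ forbidden f g a)) (#+#not (forbidden f g a)))
    where
    ring : ∀ x y → 1 * (y * 200) + x * 200 + 0 ≡ 1 * ((x + y) * 199) + (x + y)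
    ring = solve-∀
    identity : ∀ x y → x + y ≡ n → 1 * (y * 200) + x * 200 + 0 ≡ 1 * (n * 199) + n
    identity x y refl = ring x y

  heavy-moment : ∀ d f g → ∑ (samples d) (avoids (f , g)) * 200 ^ (# (heavy f g) * d)
    ≤ (n ^ d) ^ n * 199 ^ (# (heavy f g) * d)
  heavy-moment d f g = begin
    ∑ (samples d) (avoids (f , g)) * 200 ^ (# (heavy f g) * d)
      ≡⟨ cong₂ _*_ (∑-avoids d f g) (pow 200) ⟩
    ∏[ a ∈ allFin n ] (# (not ∘ forbidden f g a) ^ d) * ∏[ a ∈ allFin n ] ((200 ^ ⟦ heavy f g a ⟧) ^ d)
      ≡⟨ ∏-* (allFin n) _ _ ⟨
    ∏[ a ∈ allFin n ] (# (not ∘ forbidden f g a) ^ d * (200 ^ ⟦ heavy f g a ⟧) ^ d)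
      ≤⟨ ∏-mono (allFin n) factor ⟩
    ∏[ a ∈ allFin n ] (n ^ d * (199 ^ ⟦ heavy f g a ⟧) ^ d)
      ≡⟨ ∏-* (allFin n) _ _ ⟩
    ∏[ _ ∈ allFin n ] (n ^ d) * ∏[ a ∈ allFin n ] ((199 ^ ⟦ heavy f g a ⟧) ^ d)
      ≡⟨ cong₂ _*_ (∏-allFin-const n (n ^ d)) (sym (pow 199)) ⟩
    (n ^ d) ^ n * 199 ^ (# (heavy f g) * d) ∎
    where
    open ≤-Reasoning
    pow : ∀ c → c ^ (# (heavy f g) * d) ≡ ∏[ a ∈ allFin n ] ((c ^ ⟦ heavy f g a ⟧) ^ d)
    pow c = trans (cong (c ^_) (sym (∑-*ʳ (allFin n) _ d)))
      (trans (^-∑ (allFin n) _ c) (∏-cong (allFin n) (λ a → sym (^-*-assoc c ⟦ heavy f g a ⟧ d))))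
    factor : ∀ a → # (not ∘ forbidden f g a) ^ d * (200 ^ ⟦ heavy f g a ⟧) ^ d ≤ n ^ d * (199 ^ ⟦ heavy f g a ⟧) ^ d
    factor a = subst₂ _≤_ (^-distribʳ-* (# (not ∘ forbidden f g a)) _ d) (^-distribʳ-* n _ d)
      (^-monoˡ-≤ d (heavy-factor f g a))

  descale-^ : ∀ x c {s t} → x * 200 ^ t ≤ c * 199 ^ t → s ≤ t → x * 200 ^ s ≤ c * 199 ^ s
  descale-^ x c {s} {t} h s≤t with t ∸ s | m+[n∸m]≡n s≤t
  ... | r | refl = *-cancelʳ-≤ _ _ (200 ^ r) {{m^n≢0 200 r}} (begin
    x * 200 ^ s * 200 ^ r    ≡⟨ *-assoc x _ _ ⟩
    x * (200 ^ s * 200 ^ r)  ≡⟨ cong (x *_) (^-distribˡ-+-* 200 s r) ⟨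
    x * 200 ^ (s + r)        ≤⟨ h ⟩
    c * 199 ^ (s + r)        ≡⟨ cong (c *_) (^-distribˡ-+-* 199 s r) ⟩
    c * (199 ^ s * 199 ^ r)  ≡⟨ *-assoc c _ _ ⟨
    c * 199 ^ s * 199 ^ r    ≤⟨ *-monoʳ-≤ (c * 199 ^ s) (^-monoˡ-≤ r (n≤1+n 199)) ⟩
    c * 199 ^ s * 200 ^ r    ∎)
    where open ≤-Reasoning

  -- A given pair of labellings is missed with probability at most (199/200)^(800qn), and there
  -- are at most 2^(4qn) pairs.
  random-graph : ∀ q → 0 < q → 0 < n → κ ≤ 2 ^ (q * 2) →
    ∃ λ (ω : Fin n → Fin (q * 160000) → Fin n) → ∀ f g → n ≤ # (heavy f g) * 200 →
      ∃ λ a → ∃ λ i → forbidden f g a (ω a i) ≡ true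
  random-graph q 0<q 0<n κ≤ = entry (proj₁ good) , hit
    where
    open ≤-Reasoning
    d = q * 160000
    e = q * n * 4
    Q = (n ^ d) ^ n
    labellings = vectors (allFin κ) n
    dense? : Decidable (λ ((f , g) : Vec (Fin κ) n × Vec (Fin κ) n) → n ≤ # (heavy f g) * 200)
    dense? (f , g) = n ≤? # (heavy f g) * 200
    pairs = filter dense? (cartesianProduct labellings labellings)
    instance
      e≢0 : NonZero e
      e≢0 = >-nonZero (*-mono-< (*-mono-< 0<q 0<n) (s≤s (z≤n {3})))
      Q≢0 : NonZero Q
      Q≢0 = m^n≢0 (n ^ d) n {{m^n≢0 n d {{>-nonZero 0<n}}}}
    few : length labellings ≤ 2 ^ (q * 2 * n)
    few = begin
      length labellings    ≡⟨ length-vectors (allFin κ) n ⟩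
      length (allFin κ) ^ n ≡⟨ cong (_^ n) (Listₚ.length-tabulate {n = κ} id) ⟩
      κ ^ n                ≤⟨ ^-monoˡ-≤ n κ≤ ⟩
      (2 ^ (q * 2)) ^ n    ≡⟨ ^-*-assoc 2 (q * 2) n ⟩
      2 ^ (q * 2 * n)      ∎
    few-pairs : length pairs ≤ 2 ^ e
    few-pairs = begin
      length pairs                                    ≤⟨ Listₚ.length-filter dense? (cartesianProduct labellings labellings) ⟩
      length (cartesianProduct labellings labellings) ≡⟨ length-cartesianProductWith _,_ labellings labellings ⟩
      length labellings * length labellings           ≤⟨ *-mono-≤ few few ⟩
      2 ^ (q * 2 * n) * 2 ^ (q * 2 * n)               ≡⟨ ^-distribˡ-+-* 2 (q * 2 * n) (q * 2 * n) ⟨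
      2 ^ (q * 2 * n + q * 2 * n)                     ≡⟨ cong (2 ^_) (eq q n) ⟩
      2 ^ e                                           ∎
      where
      eq : ∀ q n → q * 2 * n + q * 2 * n ≡ q * n * 4
      eq = solve-∀
    moment : ∀ {fg} → fg List.∈ pairs → ∑ (samples d) (avoids fg) * 200 ^ (200 * e) ≤ Q * 199 ^ (200 * e)
    moment {f , g} fg∈ = descale-^ (∑ (samples d) (avoids (f , g))) Q (heavy-moment d f g) (begin
      200 * e                             ≡⟨ eq₁ q n ⟩
      n * (q * 800)                       ≤⟨ *-monoˡ-≤ (q * 800) dense ⟩
      # (heavy f g) * 200 * (q * 800)     ≡⟨ eq₂ q (# (heavy f g)) ⟩
      # (heavy f g) * d                   ∎)
      where
      dense : n ≤ # (heavy f g) * 200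
      dense = proj₂ (∈-filter⁻ dense? {xs = cartesianProduct labellings labellings} fg∈)
      eq₁ : ∀ q n → 200 * (q * n * 4) ≡ n * (q * 800)
      eq₁ = solve-∀
      eq₂ : ∀ q h → h * 200 * (q * 800) ≡ h * (q * 160000)
      eq₂ = solve-∀
    average : length pairs * (Q * 199 ^ (200 * e)) < length (samples d) * 1 * 200 ^ (200 * e)
    average = begin-strict
      length pairs * (Q * 199 ^ (200 * e))   ≤⟨ *-monoˡ-≤ _ few-pairs ⟩
      2 ^ e * (Q * 199 ^ (200 * e))          ≡⟨ regroup (2 ^ e) Q _ ⟩
      Q * (2 ^ e * 199 ^ (200 * e))          ≡⟨ cong (λ x → Q * (2 ^ e * x)) (^-*-assoc 199 200 e) ⟨
      Q * (2 ^ e * (199 ^ 200) ^ e)          ≡⟨ cong (Q *_) (^-distribʳ-* 2 (199 ^ 200) e) ⟨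
      Q * (2 * 199 ^ 200) ^ e                <⟨ *-monoʳ-< Q (^-monoˡ-< e (toWitness {a? = 2 * 199 ^ 200 <? 200 ^ 200} _)) ⟩
      Q * (200 ^ 200) ^ e                    ≡⟨ cong (Q *_) (^-*-assoc 200 200 e) ⟩
      Q * 200 ^ (200 * e)                    ≡⟨ cong (_* 200 ^ (200 * e)) (trans (*-identityʳ _) size) ⟨
      length (samples d) * 1 * 200 ^ (200 * e) ∎
      where
      regroup : ∀ a b c → a * (b * c) ≡ b * (a * c)
      regroup = solve-∀
      size : length (samples d) ≡ Q
      size = trans (length-vectors (vectors (allFin n) d) n) (cong (_^ n)
        (trans (length-vectors (allFin n) d) (cong (_^ d) (Listₚ.length-tabulate {n = n} id))))
    good : ∃ λ ω → ∀ {fg} → fg List.∈ pairs → avoids fg ω < 1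
    good = union-bound (samples d) pairs avoids (200 ^ (200 * e)) (Q * 199 ^ (200 * e)) 1 moment average
    hit : ∀ f g → n ≤ # (heavy f g) * 200 → ∃ λ a → ∃ λ i → forbidden f g a (entry (proj₁ good) a i) ≡ true
    hit f g dense =
      let a , h₁ = ∏<1⇒∃ (allFin n) _ (proj₂ good (∈-filter⁺ dense?
                     (∈-cartesianProduct⁺ (∈-vectors ∈-allFin f) (∈-vectors ∈-allFin g)) dense))
          i , h₂ = ∏<1⇒∃ (allFin d) _ h₁
      in  a , i , ⟦not⟧<1 _ h₂

-- Labellings by the parts of a blow-up

marked : Fin (suc k) → Bool
marked zero    = false
marked (suc _) = true

does⇒ : ∀ {P : Set} (d : Dec P) → does d ≡ true → P
does⇒ (yes p) _ = p

∧-true : ∀ {a b} → a ∧ b ≡ true → a ≡ true × b ≡ true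
∧-true {true} {true} _ = refl , refl

trim : ∀ (S : Subset k) t → t ≤ ∣ S ∣ → ∃ λ X → ∣ X ∣ ≡ t × (∀ i → lookup X i ≡ true → lookup S i ≡ true)
trim []          zero    _ = [] , refl , λ ()
trim (false ∷ S) t       h with trim S t h
... | X , size , sub = outside ∷ X , size , λ { (suc i) → sub i }
trim (true ∷ S)  zero    h with trim S zero z≤n
... | X , size , sub = outside ∷ X , size , λ { (suc i) → sub i }
trim (true ∷ S)  (suc t) h with trim S t (s≤s⁻¹ h)
... | X , size , sub = inside ∷ X , cong suc size , λ { zero _ → refl ; (suc i) → sub i }

module _ (f : Vec (Fin (suc k)) n) (s : ℕ) .{{_ : NonZero s}}
         (fibres : ∀ p → # (λ i → does (lookup f i Finₚ.≟ suc p)) ≤ s) where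

  select : ∀ (P : Fin n → Bool) t → (∀ i → P i ≡ true → marked (lookup f i) ≡ true) → t * s ≤ # P →
    ∃ λ X → ∣ X ∣ ≡ t × (∀ p → lookup X p ≡ true → ∃ λ i → P i ≡ true × lookup f i ≡ suc p)
  select P t P⇒marked h =
    let X , size , sub = trim image t (*-cancelʳ-≤ t ∣ image ∣ s (≤-trans h #P≤))
    in  X , size , λ p p∈X → does⇒ (hit? p) (trans (sym (Vecₚ.lookup∘tabulate _ p)) (sub p p∈X))
    where
    hit? : ∀ p → Dec (∃ λ i → P i ≡ true × lookup f i ≡ suc p)
    hit? p = Finₚ.any? (λ i → (P i Bool.≟ true) ×-dec (lookup f i Finₚ.≟ suc p))
    image : Subset k
    image = Vec.tabulate (does ∘ hit?)
    over : Fin n → Fin k → ℕ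
    over i p = ⟦ P i ∧ does (lookup f i Finₚ.≟ suc p) ⟧
    cover : ∀ i → ⟦ P i ⟧ ≤ ∑[ p ∈ allFin k ] over i p
    cover i with P i in Pi
    ... | false = z≤n
    ... | true with lookup f i | P⇒marked i Pi
    ...   | suc p | _ = ≤-trans (≤-reflexive (cong ⟦_⟧ (sym (dec-true (suc p Finₚ.≟ suc p) refl))))
      (term≤∑ (λ r → ⟦ does (suc p Finₚ.≟ suc r) ⟧) (∈-allFin p))
    capped : ∀ p → ∑[ i ∈ allFin n ] over i p ≤ ⟦ does (hit? p) ⟧ * s
    capped p with hit? p
    ... | yes _ = ≤-trans (#-mono (λ i h → proj₂ (∧-true {P i} h))) (≤-trans (fibres p) (m≤m+n s 0))
    ... | no ¬hit = ≤-trans (∑-mono (allFin n) none) (≤-reflexive (trans (∑-allFin-const n 0) (*-zeroʳ n)))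
      where
      none : ∀ i → over i p ≤ 0
      none i with P i in Pi | lookup f i Finₚ.≟ suc p
      ... | true  | yes e = contradiction (i , Pi , e) ¬hit
      ... | true  | no _  = z≤n
      ... | false | _     = z≤n
    #P≤ : # P ≤ ∣ image ∣ * s
    #P≤ = begin
      # P                                               ≤⟨ ∑-mono (allFin n) cover ⟩
      ∑[ i ∈ allFin n ] ∑[ p ∈ allFin k ] over i p      ≡⟨ ∑-swap (allFin n) (allFin k) over ⟩
      ∑[ p ∈ allFin k ] ∑[ i ∈ allFin n ] over i p      ≤⟨ ∑-mono (allFin k) capped ⟩
      ∑[ p ∈ allFin k ] (⟦ does (hit? p) ⟧ * s)         ≡⟨ ∑-*ʳ (allFin k) _ s ⟩
      # (does ∘ hit?) * s                               ≡⟨ cong (_* s) (∑-cong (allFin k) (λ p → cong ⟦_⟧ (Vecₚ.lookup∘tabulate (does ∘ hit?) p))) ⟨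
      # (lookup image) * s                              ≡⟨ cong (_* s) (∣S∣≡# image) ⟨
      ∣ image ∣ * s                                     ∎
      where open ≤-Reasoning

-- Label zero marks the vertices outside A′ and B′; suc p marks those embedded in the part p.
conflict : (Fin k → Fin k → Bool) → Fin (suc k) → Fin (suc k) → Bool
conflict R zero    _       = false
conflict R (suc p) zero    = false
conflict R (suc p) (suc r) = not (R p r)

module _ (R : Fin k → Fin k → Bool) (t s : ℕ) .{{t≢0 : NonZero t}} .{{_ : NonZero s}}
         (ts≤n : t * s * 10 ≤ n) where

  precedes : Fin k → Fin (suc k) → Bool
  precedes p zero    = false
  precedes p (suc r) = R p r

  precursors : Subset k → Fin (suc k) → ℕ
  precursors X y = ∑[ p ∈ allFin k ] (⟦ lookup X p ⟧ * ⟦ precedes p y ⟧)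

  precursors≤ : ∀ X y → precursors X y ≤ ∣ X ∣
  precursors≤ X y = subst (precursors X y ≤_) (sym (∣S∣≡# X)) (∑-mono (allFin k)
    (λ p → ≤-trans (*-monoʳ-≤ ⟦ lookup X p ⟧ (⟦b⟧≤1 (precedes p y))) (≤-reflexive (*-identityʳ ⟦ lookup X p ⟧))))

  ∑-precursors : ∀ X (g : Vec (Fin (suc k)) n) →
    ∑[ b ∈ allFin n ] precursors X (lookup g b) ≡ ∑[ p ∈ allFin k ] (⟦ lookup X p ⟧ * # (precedes p ∘ lookup g))
  ∑-precursors X g = trans (∑-swap (allFin n) (allFin k) _) (∑-cong (allFin k) (λ p → ∑-*ˡ (allFin n) _ ⟦ lookup X p ⟧))

  ∑-precursors-edges : ∀ X Y → ∑[ r ∈ allFin k ] (⟦ lookup Y r ⟧ * precursors X (suc r)) ≡ edges R X Y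
  ∑-precursors-edges X Y = begin
    ∑[ r ∈ allFin k ] (⟦ lookup Y r ⟧ * precursors X (suc r))
      ≡⟨ ∑-cong (allFin k) (λ r → sym (∑-*ˡ (allFin k) _ ⟦ lookup Y r ⟧)) ⟩
    ∑[ r ∈ allFin k ] ∑[ p ∈ allFin k ] (⟦ lookup Y r ⟧ * (⟦ lookup X p ⟧ * ⟦ R p r ⟧))
      ≡⟨ ∑-swap (allFin k) (allFin k) _ ⟩
    ∑[ p ∈ allFin k ] ∑[ r ∈ allFin k ] (⟦ lookup Y r ⟧ * (⟦ lookup X p ⟧ * ⟦ R p r ⟧))
      ≡⟨ ∑-cong (allFin k) (λ p → ∑-cong (allFin k) (λ r → conj (lookup X p) (lookup Y r) (R p r))) ⟩
    edges R X Y ∎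
    where
    open ≡-Reasoning
    conj : ∀ x y z → ⟦ y ⟧ * (⟦ x ⟧ * ⟦ z ⟧) ≡ ⟦ x ∧ (y ∧ z) ⟧
    conj true  true  z = trans (+-identityʳ _) (+-identityʳ _)
    conj true  false z = refl
    conj false true  z = refl
    conj false false z = refl

  popular : Subset k → Fin (suc k) → Bool
  popular X y = t * 4 ≤ᵇ precursors X y * 5

  popular⇒marked : ∀ X y → popular X y ≡ true → marked y ≡ true
  popular⇒marked X (suc _) h = refl
  popular⇒marked X zero    h =
    contradiction (≤-trans (≤ᵇ⇒≤ (t * 4) _ (subst T (sym h) _)) (≤-reflexive none)) (<⇒≱ (*-monoˡ-< 4 (>-nonZero⁻¹ t)))
    where
    none : precursors X zero * 5 ≡ 0
    none = cong (_* 5) (trans (∑-*ʳ (allFin k) (λ p → ⟦ lookup X p ⟧) 0) (*-zeroʳ (# (lookup X))))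

  precursors-popular : ∀ X y → ∣ X ∣ ≡ t → precursors X y * 5 ≤ t * 4 + ⟦ popular X y ⟧ * t
  precursors-popular X y ∣X∣≡t with popular X y in pop
  ... | true  = ≤-trans (*-monoˡ-≤ 5 (≤-trans (precursors≤ X y) (≤-reflexive ∣X∣≡t))) (≤-reflexive (eq t))
    where
    eq : ∀ t → t * 5 ≡ t * 4 + 1 * t
    eq = solve-∀
  ... | false = ≤-trans (<⇒≤ (≰⇒> λ h → subst T pop (≤⇒≤ᵇ h))) (m≤m+n _ 0)

  enough-popular : ∀ X (g : Vec (Fin (suc k)) n) → ∣ X ∣ ≡ t →
    (∀ p → lookup X p ≡ true → n * 193 ≤ # (precedes p ∘ lookup g) * 200) → t * s ≤ # (popular X ∘ lookup g)
  enough-popular X g ∣X∣≡t rows = *-cancelˡ-≤ t (linear 39 (t * n * 29)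
    (+-mono-≤ lower (+-mono-≤ (*-monoˡ-≤ 40 upper) (*-monoʳ-≤ (t * 4) ts≤n)))
    (eq n t s (# (popular X ∘ lookup g)) total))
    where
    open ≤-Reasoning
    total = ∑[ b ∈ allFin n ] precursors X (lookup g b)
    eq : ∀ n t s p d → 40 * (t * (t * s)) + (d * 200 + ((n * (t * 4) + p * t) * 40 + t * 4 * n)) + t * n * 29
      ≡ 40 * (t * p) + (t * (n * 193) + (d * 5 * 40 + t * 4 * (t * s * 10)))
    eq = solve-∀
    row : ∀ p → ⟦ lookup X p ⟧ * (n * 193) ≤ ⟦ lookup X p ⟧ * # (precedes p ∘ lookup g) * 200
    row p with lookup X p | rows p
    ... | false | _ = z≤n
    ... | true  | h = subst (1 * (n * 193) ≤_) (sym (*-assoc 1 (# (precedes p ∘ lookup g)) 200)) (*-monoʳ-≤ 1 (h refl))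
    lower : t * (n * 193) ≤ total * 200
    lower = begin
      t * (n * 193)                                                      ≡⟨ cong (_* (n * 193)) (trans (sym ∣X∣≡t) (∣S∣≡# X)) ⟩
      # (lookup X) * (n * 193)                                           ≡⟨ ∑-*ʳ (allFin k) _ (n * 193) ⟨
      ∑[ p ∈ allFin k ] (⟦ lookup X p ⟧ * (n * 193))                     ≤⟨ ∑-mono (allFin k) row ⟩
      ∑[ p ∈ allFin k ] (⟦ lookup X p ⟧ * # (precedes p ∘ lookup g) * 200)     ≡⟨ ∑-*ʳ (allFin k) _ 200 ⟩
      (∑[ p ∈ allFin k ] (⟦ lookup X p ⟧ * # (precedes p ∘ lookup g))) * 200   ≡⟨ cong (_* 200) (∑-precursors X g) ⟨
      total * 200 ∎
    upper : total * 5 ≤ n * (t * 4) + # (popular X ∘ lookup g) * t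
    upper = begin
      total * 5                                                          ≡⟨ ∑-*ʳ (allFin n) _ 5 ⟨
      ∑[ b ∈ allFin n ] (precursors X (lookup g b) * 5)                  ≤⟨ ∑-mono (allFin n) (λ b → precursors-popular X (lookup g b) ∣X∣≡t) ⟩
      ∑[ b ∈ allFin n ] (t * 4 + ⟦ popular X (lookup g b) ⟧ * t)         ≡⟨ ∑-+ (allFin n) _ _ ⟩
      ∑[ _ ∈ allFin n ] (t * 4) + ∑[ b ∈ allFin n ] (⟦ popular X (lookup g b) ⟧ * t)
        ≡⟨ cong₂ _+_ (∑-allFin-const n (t * 4)) (∑-*ʳ (allFin n) _ t) ⟩
      n * (t * 4) + # (popular X ∘ lookup g) * t ∎

  popular-edges : ∀ X Y → ∣ Y ∣ ≡ t → (∀ r → lookup Y r ≡ true → popular X (suc r) ≡ true) → t * t * 4 ≤ edges R X Y * 5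
  popular-edges X Y ∣Y∣≡t all-popular = begin
    t * t * 4                                                          ≡⟨ *-assoc t t 4 ⟩
    t * (t * 4)                                                        ≡⟨ cong (_* (t * 4)) (trans (sym ∣Y∣≡t) (∣S∣≡# Y)) ⟩
    # (lookup Y) * (t * 4)                                             ≡⟨ ∑-*ʳ (allFin k) _ (t * 4) ⟨
    ∑[ r ∈ allFin k ] (⟦ lookup Y r ⟧ * (t * 4))                       ≤⟨ ∑-mono (allFin k) column ⟩
    ∑[ r ∈ allFin k ] (⟦ lookup Y r ⟧ * precursors X (suc r) * 5)      ≡⟨ ∑-*ʳ (allFin k) _ 5 ⟩
    (∑[ r ∈ allFin k ] (⟦ lookup Y r ⟧ * precursors X (suc r))) * 5    ≡⟨ cong (_* 5) (∑-precursors-edges X Y) ⟩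
    edges R X Y * 5 ∎
    where
    open ≤-Reasoning
    column : ∀ r → ⟦ lookup Y r ⟧ * (t * 4) ≤ ⟦ lookup Y r ⟧ * precursors X (suc r) * 5
    column r with lookup Y r | all-popular r
    ... | false | _ = z≤n
    ... | true  | h = subst (1 * (t * 4) ≤_) (sym (*-assoc 1 (precursors X (suc r)) 5))
      (*-monoʳ-≤ 1 (≤ᵇ⇒≤ (t * 4) _ (subst T (sym (h refl)) _)))

  module _ (f g : Vec (Fin (suc k)) n)
           (many-f : n * 97 ≤ # (marked ∘ lookup f) * 100) (many-g : n * 97 ≤ # (marked ∘ lookup g) * 100) where

    light : Fin n → Bool
    light a = marked (lookup f a) ∧ not (heavy (conflict R) f g a)

    enough-light : # (heavy (conflict R) f g) * 200 ≤ n → t * s ≤ # light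
    enough-light few-heavy = linear 199 (n * 173)
      (+-mono-≤ few-heavy (+-mono-≤ (*-monoˡ-≤ 2 many-f) (+-mono-≤ (*-monoˡ-≤ 20 ts≤n) (*-monoˡ-≤ 200 split))))
      (eq n (t * s) (# (heavy (conflict R) f g)) (# (marked ∘ lookup f)) (# light))
      where
      eq : ∀ n x h c l → 200 * x + (n + (c * 100 * 2 + (n * 20 + (l + h) * 200))) + n * 173
        ≡ 200 * l + (h * 200 + (n * 97 * 2 + (x * 10 * 20 + c * 200)))
      eq = solve-∀
      cases : ∀ x y → ⟦ x ⟧ ≤ ⟦ x ∧ not y ⟧ + ⟦ y ⟧
      cases false _     = z≤n
      cases true  false = s≤s z≤n
      cases true  true  = s≤s z≤n
      split : # (marked ∘ lookup f) ≤ # light + # (heavy (conflict R) f g)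
      split = ≤-trans (∑-mono (allFin n) (λ a → cases (marked (lookup f a)) (heavy (conflict R) f g a)))
        (≤-reflexive (∑-+ (allFin n) _ _))

    light-row : ∀ a p → light a ≡ true → lookup f a ≡ suc p → n * 193 ≤ # (precedes p ∘ lookup g) * 200
    light-row a p a-light fa≡ = linear 0 0 (+-mono-≤ (*-monoˡ-≤ 2 many-g) (+-mono-≤ (*-monoˡ-≤ 200 split) few))
      (eq n (# (marked ∘ lookup g)) (# (precedes p ∘ lookup g)) (# (forbidden (conflict R) f g a)))
      where
      eq : ∀ n c o h → 1 * (n * 193) + (c * 100 * 2 + ((o + h) * 200 + n)) + 0
        ≡ 1 * (o * 200) + (n * 97 * 2 + (c * 200 + h * 200))
      eq = solve-∀
      not-heavy : heavy (conflict R) f g a ≡ false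
      not-heavy with heavy (conflict R) f g a | proj₂ (∧-true {marked (lookup f a)} a-light)
      ... | false | _ = refl
      few : # (forbidden (conflict R) f g a) * 200 ≤ n
      few = <⇒≤ (≰⇒> λ h → subst T not-heavy (≤⇒≤ᵇ h))
      cases : ∀ x y → x ≡ suc p → ⟦ marked y ⟧ ≤ ⟦ precedes p y ⟧ + ⟦ conflict R x y ⟧
      cases _ zero    refl = z≤n
      cases _ (suc r) refl with R p r
      ... | true  = s≤s z≤n
      ... | false = s≤s z≤n
      split : # (marked ∘ lookup g) ≤ # (precedes p ∘ lookup g) + # (forbidden (conflict R) f g a)
      split = ≤-trans (∑-mono (allFin n) (λ b → cases (lookup f a) (lookup g b) fa≡)) (≤-reflexive (∑-+ (allFin n) _ _))

  -- Otherwise select X among the parts of light vertices a, then Y among the parts of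
  -- vertices b that most of X may precede: too many pairs of X × Y satisfy R.
  heavy-labels : (∀ X Y → ∣ X ∣ ≡ t → ∣ Y ∣ ≡ t → edges R X Y * 5 < t * t * 4) →
    ∀ (f g : Vec (Fin (suc k)) n) →
    (∀ p → # (λ a → does (lookup f a Finₚ.≟ suc p)) ≤ s) →
    (∀ p → # (λ b → does (lookup g b Finₚ.≟ suc p)) ≤ s) →
    n * 97 ≤ # (marked ∘ lookup f) * 100 →
    n * 97 ≤ # (marked ∘ lookup g) * 100 →
    n ≤ # (heavy (conflict R) f g) * 200
  heavy-labels sparse f g fibres-f fibres-g many-f many-g = ≮⇒≥ λ few-heavy →
    let X , ∣X∣≡t , from-f = select f s fibres-f (light f g many-f many-g) t
          (λ a h → proj₁ (∧-true {marked (lookup f a)} h)) (enough-light f g many-f many-g (<⇒≤ few-heavy))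
        Y , ∣Y∣≡t , from-g = select g s fibres-g (popular X ∘ lookup g) t (λ b → popular⇒marked X (lookup g b))
          (enough-popular X g ∣X∣≡t λ p p∈X →
            let a , a-light , fa≡ = from-f p p∈X in light-row f g many-f many-g a p a-light fa≡)
    in  <⇒≱ (sparse X Y ∣X∣≡t ∣Y∣≡t) (popular-edges X Y ∣Y∣≡t λ r r∈Y →
          let b , b-popular , gb≡ = from-g r r∈Y in subst (λ y → popular X y ≡ true) gb≡ b-popular)

≡-T : ∀ {b} → T b → b ≡ true
≡-T {true} _ = refl

-- Blow-ups, bipartite digraphs and copies

#-unique : ∀ (p : Fin n → Bool) → (∀ {i j} → p i ≡ true → p j ≡ true → i ≡ j) → # p ≤ 1
#-unique {zero}  p _ = z≤n
#-unique {suc n} p unique = subst (_≤ 1) (sym (∑-allFin-suc (⟦_⟧ ∘ p))) split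
  where
  tail≤ : # (p ∘ suc) ≤ 1
  tail≤ = #-unique (p ∘ suc) (λ pi pj → Finₚ.suc-injective (unique pi pj))
  split : ⟦ p zero ⟧ + # (p ∘ suc) ≤ 1
  split with p zero in p0
  ... | false = tail≤
  ... | true  = s≤s (≤-trans (∑-mono (allFin n) none) (≤-reflexive (trans (∑-allFin-const n 0) (*-zeroʳ n))))
    where
    none : ∀ i → ⟦ p (suc i) ⟧ ≤ 0
    none i with p (suc i) in pi
    ... | false = z≤n
    ... | true  with () ← unique p0 pi

part : ∀ {s} → Maybe (Fin k × Fin s) → Fin (suc k)
part nothing        = zero
part (just (p , _)) = suc p

part-fibre : ∀ {s} (γ : Fin n → Maybe (Fin k × Fin s)) → (∀ {i j x} → γ i ≡ just x → γ j ≡ just x → i ≡ j) →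
  ∀ p → # (λ i → does (part (γ i) Finₚ.≟ suc p)) ≤ s
part-fibre {n} {s = s} γ inj p = begin
  # (λ i → does (part (γ i) Finₚ.≟ suc p))           ≤⟨ ∑-mono (allFin n) (λ i → cover (γ i)) ⟩
  ∑[ i ∈ allFin n ] ∑[ r ∈ allFin s ] ⟦ at (γ i) r ⟧ ≡⟨ ∑-swap (allFin n) (allFin s) _ ⟩
  ∑[ r ∈ allFin s ] # (λ i → at (γ i) r)             ≤⟨ ∑-mono (allFin s) (λ r → #-unique _ (λ hi hj → inj (at⇒ hi) (at⇒ hj))) ⟩
  ∑[ _ ∈ allFin s ] 1                                ≡⟨ trans (∑-allFin-const s 1) (*-identityʳ s) ⟩
  s ∎
  where
  open ≤-Reasoning
  at : Maybe (Fin _ × Fin s) → Fin s → Bool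
  at nothing         _ = false
  at (just (p′ , r′)) r = does (p′ Finₚ.≟ p) ∧ does (r′ Finₚ.≟ r)
  at⇒ : ∀ {c r} → at c r ≡ true → c ≡ just (p , r)
  at⇒ {just (p′ , r′)} {r} h with ∧-true {does (p′ Finₚ.≟ p)} h
  ... | h₁ , h₂ = cong₂ (λ x y → just (x , y)) (does⇒ (p′ Finₚ.≟ p) h₁) (does⇒ (r′ Finₚ.≟ r) h₂)
  cover : ∀ c → ⟦ does (part c Finₚ.≟ suc p) ⟧ ≤ ∑[ r ∈ allFin s ] ⟦ at c r ⟧
  cover nothing = z≤n
  cover (just (p′ , r′)) with p′ Finₚ.≟ p
  ... | no _  = z≤n
  ... | yes _ = ≤-reflexive (sym (∑-≟ r′))

module BlowUp {M s : ℕ} (T : Fin k → Fin k → Bool) (T-antisym : ∀ {p r} → p ≢ r → T r p ≡ not (T p r))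
              (place : Fin M → Fin k × Fin s) where

  arrow : Fin M → Fin M → Bool
  arrow u v = if does (proj₁ (place u) Finₚ.≟ proj₁ (place v)) then u ≺ v else T (proj₁ (place u)) (proj₁ (place v))

  arrow⇒ : ∀ u v → arrow u v ≡ true →
    T (proj₁ (place u)) (proj₁ (place v)) ∨ does (proj₁ (place u) Finₚ.≟ proj₁ (place v)) ≡ true
  arrow⇒ u v h with proj₁ (place u) Finₚ.≟ proj₁ (place v)
  ... | no  _ rewrite h = refl
  ... | yes _ with T (proj₁ (place u)) (proj₁ (place v))
  ...   | true  = refl
  ...   | false = refl

  arrow-irrefl : ∀ u → arrow u u ≡ true → u ≢ u
  arrow-irrefl u h with proj₁ (place u) Finₚ.≟ proj₁ (place u)
  ... | yes _ = contradiction (≺⇒< u u h) (<-irrefl refl)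
  ... | no ¬p = contradiction refl ¬p

  arrow-antisym : ∀ u v → u ≢ v → arrow v u ≡ not (arrow u v)
  arrow-antisym u v u≢v with proj₁ (place u) Finₚ.≟ proj₁ (place v) | proj₁ (place v) Finₚ.≟ proj₁ (place u)
  ... | yes p | no ¬q = contradiction (sym p) ¬q
  ... | no ¬p | yes q = contradiction (sym q) ¬p
  ... | no ¬p | no _  = T-antisym ¬p
  ... | yes _ | yes _ with u ≺ v in u≺v | v ≺ u in v≺u
  ...   | true  | true  = ≺-asym u v u≺v v≺u
  ...   | true  | false = refl
  ...   | false | true  = refl
  ...   | false | false = contradiction (Finₚ.toℕ-injective (≤-antisym (⊀⇒≥ v u v≺u) (⊀⇒≥ u v u≺v))) u≢v

  blow-up : Digraph M
  blow-up = record
    { V          = ⊤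
    ; E          = λ u v → arrow u v ≡ true
    ; E?         = λ u v → arrow u v Bool.≟ true
    ; E-vertices = λ _ → ∈⊤ , ∈⊤
    ; E-irrefl   = λ { {u} refl h → arrow-irrefl u h refl }
    }

  blow-up-tournament : Tournament blow-up
  blow-up-tournament {u} {v} _ _ u≢v with arrow u v | arrow v u | arrow-antisym u v u≢v
  ... | true  | false | _ = inj₁ (refl , λ ())
  ... | false | true  | _ = inj₂ ((λ ()) , refl)

∑-allFin-+ : ∀ m n (f : Fin (m + n) → ℕ) →
  ∑ (allFin (m + n)) f ≡ ∑[ i ∈ allFin m ] f (i Fin.↑ˡ n) + ∑[ j ∈ allFin n ] f (m Fin.↑ʳ j)
∑-allFin-+ zero    n f = refl
∑-allFin-+ (suc m) n f = begin
  ∑ (allFin (suc m + n)) f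
    ≡⟨ ∑-allFin-suc f ⟩
  f zero + ∑ (allFin (m + n)) (f ∘ suc)
    ≡⟨ cong (f zero +_) (∑-allFin-+ m n (f ∘ suc)) ⟩
  f zero + (∑[ i ∈ allFin m ] f (suc (i Fin.↑ˡ n)) + ∑[ j ∈ allFin n ] f (suc (m Fin.↑ʳ j)))
    ≡⟨ +-assoc (f zero) _ _ ⟨
  f zero + ∑[ i ∈ allFin m ] f (suc (i Fin.↑ˡ n)) + ∑[ j ∈ allFin n ] f (suc (m Fin.↑ʳ j))
    ≡⟨ cong (_+ ∑[ j ∈ allFin n ] f (suc (m Fin.↑ʳ j))) (∑-allFin-suc (λ i → f (i Fin.↑ˡ n))) ⟨
  ∑[ i ∈ allFin (suc m) ] f (i Fin.↑ˡ n) + ∑[ j ∈ allFin n ] f (suc m Fin.↑ʳ j) ∎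
  where open ≡-Reasoning

#-below : ∀ Δ n → Δ ≤ n → # {n} (λ a → toℕ a <ᵇ Δ) ≡ Δ
#-below zero    n       _ = trans (∑-allFin-const n 0) (*-zeroʳ n)
#-below (suc Δ) (suc n) h = trans (∑-allFin-suc {n} (λ a → ⟦ toℕ a <ᵇ suc Δ ⟧)) (cong suc (#-below Δ n (s≤s⁻¹ h)))

does-≟true : ∀ b → does (b Bool.≟ true) ≡ b
does-≟true true  = refl
does-≟true false = refl

∈⇒lookup : ∀ {S : Subset n} {x} → x ∈ S → lookup S x ≡ true
∈⇒lookup = Vecₚ.[]=⇒lookup

lookup⇒∈ : ∀ {S : Subset n} {x} → lookup S x ≡ true → x ∈ S
lookup⇒∈ {S = S} {x} h = Vecₚ.lookup⇒[]= x S h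

module Bipartite (e : Fin n → Fin n → Bool) where

  L R′ : Subset (n + n)
  L  = ⊤ {n} Vec.++ Vec.replicate n false
  R′ = Vec.replicate n false Vec.++ ⊤ {n}

  incident : Fin n ⊎ Fin n → Fin n ⊎ Fin n → Bool
  incident (inj₁ a) (inj₂ b) = e a b
  incident _        _        = false

  ∈L : ∀ a → a Fin.↑ˡ n ∈ L
  ∈L a = lookup⇒∈ (trans (Vecₚ.lookup-++ˡ (⊤ {n}) _ a) (Vecₚ.lookup-replicate a true))

  ∈R : ∀ b → n Fin.↑ʳ b ∈ R′
  ∈R b = lookup⇒∈ (trans (Vecₚ.lookup-++ʳ (Vec.replicate n false) (⊤ {n}) b) (Vecₚ.lookup-replicate b true))

  ∉L : ∀ b → ¬ (n Fin.↑ʳ b ∈ L)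
  ∉L b b∈ with () ← trans (sym (∈⇒lookup b∈)) (trans (Vecₚ.lookup-++ʳ (⊤ {n}) _ b) (Vecₚ.lookup-replicate b false))

  ∉R : ∀ a → ¬ (a Fin.↑ˡ n ∈ R′)
  ∉R a a∈ with () ← trans (sym (∈⇒lookup a∈)) (trans (Vecₚ.lookup-++ˡ (Vec.replicate n false) (⊤ {n}) a) (Vecₚ.lookup-replicate a false))

  incident-ends : ∀ u v → incident (Fin.splitAt n u) (Fin.splitAt n v) ≡ true →
    ∃ λ a → ∃ λ b → u ≡ a Fin.↑ˡ n × v ≡ n Fin.↑ʳ b × e a b ≡ true
  incident-ends u v h with Fin.splitAt n u in u≡ | Fin.splitAt n v in v≡
  ... | inj₁ a | inj₂ b = a , b , sym (Finₚ.splitAt⁻¹-↑ˡ u≡) , sym (Finₚ.splitAt⁻¹-↑ʳ v≡) , h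

  incident-LR : ∀ a b → incident (Fin.splitAt n (a Fin.↑ˡ n)) (Fin.splitAt n (n Fin.↑ʳ b)) ≡ e a b
  incident-LR a b = cong₂ incident (Finₚ.splitAt-↑ˡ n a n) (Finₚ.splitAt-↑ʳ n n b)

  bipartite : Digraph (n + n)
  bipartite = record
    { V          = L ∪ R′
    ; E          = λ u v → incident (Fin.splitAt n u) (Fin.splitAt n v) ≡ true
    ; E?         = λ u v → incident (Fin.splitAt n u) (Fin.splitAt n v) Bool.≟ true
    ; E-vertices = λ {u} {v} h → let a , b , u≡ , v≡ , _ = incident-ends u v h in
        subst (_∈ L ∪ R′) (sym u≡) (x∈p∪q⁺ (inj₁ (∈L a))) , subst (_∈ L ∪ R′) (sym v≡) (x∈p∪q⁺ (inj₂ (∈R b)))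
    ; E-irrefl   = λ { {u} refl h → irrefl u h }
    }
    where
    irrefl : ∀ u → incident (Fin.splitAt n u) (Fin.splitAt n u) ≢ true
    irrefl u h with Fin.splitAt n u
    irrefl u () | inj₁ _
    irrefl u () | inj₂ _

  bipartite-directed : DirectedBipartite bipartite L R′
  bipartite-directed = record
    { vertices = refl
    ; disjoint = λ (u , u∈) → let u∈L , u∈R = x∈p∩q⁻ L R′ u∈ in disjoint u u∈L u∈R
    ; directed = λ {u} {v} h → let a , b , u≡ , v≡ , _ = incident-ends u v h in
        subst (_∈ L) (sym u≡) (∈L a) , subst (_∈ R′) (sym v≡) (∈R b)
    }
    where
    disjoint : ∀ u → u ∈ L → ¬ (u ∈ R′)
    disjoint u u∈L u∈R with Fin.splitAt n u in u≡
    ... | inj₁ a = ∉R a (subst (_∈ R′) (sym (Finₚ.splitAt⁻¹-↑ˡ u≡)) u∈R)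
    ... | inj₂ b = ∉L b (subst (_∈ L) (sym (Finₚ.splitAt⁻¹-↑ʳ u≡)) u∈L)

  ∣S∣-split : ∀ (S : Subset (n + n)) → ∣ S ∣ ≡ # (λ a → lookup S (a Fin.↑ˡ n)) + # (λ b → lookup S (n Fin.↑ʳ b))
  ∣S∣-split S = trans (∣S∣≡# S) (∑-allFin-+ n n (⟦_⟧ ∘ lookup S))

  #-none : ∀ (p : Fin n → Bool) → (∀ i → p i ≢ true) → # p ≡ 0
  #-none p none = trans (∑-cong (allFin n) zero-at) (trans (∑-allFin-const n 0) (*-zeroʳ n))
    where
    zero-at : ∀ i → ⟦ p i ⟧ ≡ 0
    zero-at i with p i in pi
    ... | true  = contradiction pi (none i)
    ... | false = refl

  ∣S∣-L : ∀ {S} → S ⊆ L → ∣ S ∣ ≡ # (λ a → lookup S (a Fin.↑ˡ n))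
  ∣S∣-L {S} S⊆L = trans (∣S∣-split S) (trans (cong (# (λ a → lookup S (a Fin.↑ˡ n)) +_)
    (#-none _ (λ b h → ∉L b (S⊆L (lookup⇒∈ h))))) (+-identityʳ _))

  ∣S∣-R : ∀ {S} → S ⊆ R′ → ∣ S ∣ ≡ # (λ b → lookup S (n Fin.↑ʳ b))
  ∣S∣-R {S} S⊆R = trans (∣S∣-split S) (cong (_+ # (λ b → lookup S (n Fin.↑ʳ b)))
    (#-none _ (λ a h → ∉R a (S⊆R (lookup⇒∈ h)))))

  #-all : ∀ (p : Fin n → Bool) → (∀ i → p i ≡ true) → # p ≡ n
  #-all p all = trans (∑-cong (allFin n) (λ i → cong ⟦_⟧ (all i))) (trans (∑-allFin-const n 1) (*-identityʳ n))

  ∣L∣≡n : ∣ L ∣ ≡ n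
  ∣L∣≡n = trans (∣S∣-L id) (#-all _ (∈⇒lookup ∘ ∈L))

  ∣R∣≡n : ∣ R′ ∣ ≡ n
  ∣R∣≡n = trans (∣S∣-R id) (#-all _ (∈⇒lookup ∘ ∈R))

  degree≡ : ∀ v → degree bipartite v ≡
    # (λ a → incident (inj₁ a) (Fin.splitAt n v) ∨ incident (Fin.splitAt n v) (inj₁ a)) +
    # (λ b → incident (inj₂ b) (Fin.splitAt n v) ∨ incident (Fin.splitAt n v) (inj₂ b))
  degree≡ v = trans (length-filter≡∑ _ (allFin (n + n)))
    (trans (∑-allFin-+ n n _) (cong₂ _+_
      (∑-cong (allFin n) (λ a → cong ⟦_⟧ (side (a Fin.↑ˡ n) (inj₁ a) (Finₚ.splitAt-↑ˡ n a n))))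
      (∑-cong (allFin n) (λ b → cong ⟦_⟧ (side (n Fin.↑ʳ b) (inj₂ b) (Finₚ.splitAt-↑ʳ n n b))))))
    where
    side : ∀ u x → Fin.splitAt n u ≡ x →
      does (E? bipartite u v ⊎-dec E? bipartite v u) ≡ incident x (Fin.splitAt n v) ∨ incident (Fin.splitAt n v) x
    side u x refl = cong₂ _∨_ (does-≟true (incident (Fin.splitAt n u) (Fin.splitAt n v)))
                              (does-≟true (incident (Fin.splitAt n v) (Fin.splitAt n u)))

  degree-L : ∀ a → degree bipartite (a Fin.↑ˡ n) ≡ # (e a)
  degree-L a = trans (degree≡ (a Fin.↑ˡ n)) (trans
    (cong (λ x → # (λ a → incident (inj₁ a) x ∨ incident x (inj₁ a)) + # (λ b → incident (inj₂ b) x ∨ incident x (inj₂ b)))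
      (Finₚ.splitAt-↑ˡ n a n))
    (cong (_+ # (e a)) (#-none _ (λ _ ()))))

  degree-R : ∀ b → degree bipartite (n Fin.↑ʳ b) ≡ # (λ a → e a b)
  degree-R b = trans (degree≡ (n Fin.↑ʳ b)) (trans
    (cong (λ x → # (λ a → incident (inj₁ a) x ∨ incident x (inj₁ a)) + # (λ b → incident (inj₂ b) x ∨ incident x (inj₂ b)))
      (Finₚ.splitAt-↑ʳ n n b))
    (trans (cong₂ _+_ (∑-cong (allFin n) (λ a → cong ⟦_⟧ (Boolₚ.∨-identityʳ (e a b)))) (#-none _ (λ _ ()))) (+-identityʳ _)))

  maxDegree≡ : ∀ {Δ} b₀ → (∀ a → # (e a) ≤ Δ) → (∀ b → # (λ a → e a b) ≤ Δ) → # (λ a → e a b₀) ≡ Δ →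
    maxDegree bipartite ≡ Δ
  maxDegree≡ {Δ} b₀ rows columns b₀-full = ≤-antisym
    (max≤v⁺ z≤n (All.map⁺ (All.universal bound (allFin (n + n)))))
    (v≤max⁺ 0 (map (degree bipartite) (allFin (n + n))) (inj₂ (Any.map⁺ (lose (∈-allFin (n Fin.↑ʳ b₀))
      (≤-reflexive (sym (trans (degree-R b₀) b₀-full)))))))
    where
    bound : ∀ v → degree bipartite v ≤ Δ
    bound v = side (Fin.splitAt n v) refl
      where
      side : ∀ x → Fin.splitAt n v ≡ x → degree bipartite v ≤ Δ
      side (inj₁ a) v≡ = subst (λ v → degree bipartite v ≤ Δ) (Finₚ.splitAt⁻¹-↑ˡ v≡) (subst (_≤ Δ) (sym (degree-L a)) (rows a))
      side (inj₂ b) v≡ = subst (λ v → degree bipartite v ≤ Δ) (Finₚ.splitAt⁻¹-↑ʳ v≡) (subst (_≤ Δ) (sym (degree-R b)) (columns b))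

copy-map : ∀ {M N} (D : Digraph N) S (R : Digraph M) → Copy (induced D S) R →
  ∃ λ (φ : ∀ u → u ∈ V D → u ∈ S → Fin M) →
    (∀ {u v} u∈V u∈S v∈V v∈S → φ u u∈V u∈S ≡ φ v v∈V v∈S → u ≡ v) ×
    (∀ {u v} u∈V u∈S v∈V v∈S → E D u v → E R (φ u u∈V u∈S) (φ v v∈V v∈S))
copy-map D S R (H , H⊆R , iso) = φ , φ-injective , φ-edge
  where
  open _≅_ iso using (bijection)
  open _Subdigraph_ H⊆R
  vertex : ∀ u → u ∈ V D → u ∈ S → Vertex (induced D S)
  vertex u u∈V u∈S = u , x∈p∩q⁺ (u∈V , u∈S)
  φ = λ u u∈V u∈S → proj₁ (Inverse.to bijection (vertex u u∈V u∈S))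
  irrelevant : ∀ {x y : Vertex H} → proj₁ x ≡ proj₁ y → x ≡ y
  irrelevant {u , p} {_ , q} refl = cong (u ,_) ([]=-irrelevant p q)
  φ-injective : ∀ {u v} u∈V u∈S v∈V v∈S → φ u u∈V u∈S ≡ φ v v∈V v∈S → u ≡ v
  φ-injective u∈V u∈S v∈V v∈S eq = cong proj₁ (Injection.injective (↔⇒↣ bijection) (irrelevant eq))
  φ-edge : ∀ {u v} u∈V u∈S v∈V v∈S → E D u v → E R (φ u u∈V u∈S) (φ v v∈V v∈S)
  φ-edge u∈V u∈S v∈V v∈S uv = E-⊆ (Equivalence.to (_≅_.edges iso (vertex _ u∈V u∈S) (vertex _ v∈V v∈S)) (uv , u∈S , v∈S))

edge⇒edgesBetween : ∀ (D : Digraph n) {S S′ u v} → u ∈ S → v ∈ S′ → E D u v → edgesBetween D S S′ > 0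
edge⇒edgesBetween D {S} {S′} {u} {v} u∈S v∈S′ uv =
  ∈-length (∈-filter⁺ (λ (u , v) → (u ∈? S) ×-dec (v ∈? S′) ×-dec E? D u v)
    (∈-cartesianProduct⁺ (∈-allFin u) (∈-allFin v)) (u∈S , v∈S′ , uv))

-- The construction

module Truncation {n d : ℕ} (ω : Fin n → Fin d → Fin n) (Δ : ℕ) (Δ≤n : Δ ≤ n) (b₀ : Fin n) where

  chosen? : ∀ a b → Dec (∃ λ i → ω a i ≡ b)
  chosen? a b = Finₚ.any? (λ i → ω a i Finₚ.≟ b)

  chosen : Fin n → Fin n → Bool
  chosen a b = does (chosen? a b)

  indegree : Fin n → ℕ
  indegree b = # (λ a → chosen a b)

  -- Vertices of B chosen more than Δ times lose all their edges, and b₀ gets exactly Δ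
  -- neighbours, so that the maximum degree is Δ.
  adjacent : Fin n → Fin n → Bool
  adjacent a b = if does (b₀ Finₚ.≟ b) then toℕ a <ᵇ Δ else (indegree b ≤ᵇ Δ) ∧ chosen a b

  intact : Fin n → Bool
  intact b = not (does (b₀ Finₚ.≟ b)) ∧ (indegree b ≤ᵇ Δ)

  intact-edge : ∀ a i → intact (ω a i) ≡ true → adjacent a (ω a i) ≡ true
  intact-edge a i h with b₀ Finₚ.≟ ω a i
  ... | no _ rewrite h = dec-true (chosen? a (ω a i)) (i , refl)

  #chosen≤d : ∀ a → # (chosen a) ≤ d
  #chosen≤d a = begin
    # (chosen a)                                                  ≤⟨ ∑-mono (allFin n) cover ⟩
    ∑[ b ∈ allFin n ] # (λ i → does (ω a i Finₚ.≟ b))             ≡⟨ ∑-swap (allFin n) (allFin d) _ ⟩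
    ∑[ i ∈ allFin d ] # (λ b → does (ω a i Finₚ.≟ b))             ≡⟨ ∑-cong (allFin d) (λ i → ∑-≟ (ω a i)) ⟩
    ∑[ _ ∈ allFin d ] 1                                           ≡⟨ trans (∑-allFin-const d 1) (*-identityʳ d) ⟩
    d ∎
    where
    open ≤-Reasoning
    cover : ∀ b → ⟦ chosen a b ⟧ ≤ # (λ i → does (ω a i Finₚ.≟ b))
    cover b with chosen? a b
    ... | no _ = z≤n
    ... | yes (i , refl) = ≤-trans (≤-reflexive (cong ⟦_⟧ (sym (dec-true (ω a i Finₚ.≟ ω a i) refl))))
      (term≤∑ (λ j → ⟦ does (ω a j Finₚ.≟ ω a i) ⟧) (∈-allFin i))

  rows : suc d ≤ Δ → ∀ a → # (adjacent a) ≤ Δ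
  rows d<Δ a = begin
    # (adjacent a)
      ≤⟨ ∑-mono (allFin n) split ⟩
    ∑[ b ∈ allFin n ] (⟦ does (b₀ Finₚ.≟ b) ⟧ + ⟦ chosen a b ⟧)
      ≡⟨ ∑-+ (allFin n) _ _ ⟩
    # (λ b → does (b₀ Finₚ.≟ b)) + # (chosen a)
      ≤⟨ +-mono-≤ (≤-reflexive (∑-≟ b₀)) (#chosen≤d a) ⟩
    suc d
      ≤⟨ d<Δ ⟩
    Δ ∎
    where
    open ≤-Reasoning
    split : ∀ b → ⟦ adjacent a b ⟧ ≤ ⟦ does (b₀ Finₚ.≟ b) ⟧ + ⟦ chosen a b ⟧
    split b with does (b₀ Finₚ.≟ b)
    ... | true  = ≤-trans (⟦b⟧≤1 (toℕ a <ᵇ Δ)) (s≤s z≤n)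
    ... | false = ⟦⟧-mono (λ h → proj₂ (∧-true {indegree b ≤ᵇ Δ} h))

  b₀-full : # (λ a → adjacent a b₀) ≡ Δ
  b₀-full = trans (∑-cong (allFin n) (λ a → cong (λ x → ⟦ if x then toℕ a <ᵇ Δ else (indegree b₀ ≤ᵇ Δ) ∧ chosen a b₀ ⟧)
    (dec-true (b₀ Finₚ.≟ b₀) refl))) (#-below Δ n Δ≤n)

  columns : ∀ b → # (λ a → adjacent a b) ≤ Δ
  columns b with b₀ Finₚ.≟ b
  ... | yes _ = ≤-reflexive (#-below Δ n Δ≤n)
  ... | no  _ with indegree b ≤ᵇ Δ in h
  ...   | true  = ≤ᵇ⇒≤ (indegree b) Δ (subst T (sym h) _)
  ...   | false = ≤-trans (≤-reflexive (trans (∑-allFin-const n 0) (*-zeroʳ n))) z≤n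

  #overfull : # (λ b → not (indegree b ≤ᵇ Δ)) * Δ ≤ n * d
  #overfull = begin
    # (λ b → not (indegree b ≤ᵇ Δ)) * Δ                    ≡⟨ ∑-*ʳ (allFin n) _ Δ ⟨
    ∑[ b ∈ allFin n ] (⟦ not (indegree b ≤ᵇ Δ) ⟧ * Δ)       ≤⟨ ∑-mono (allFin n) overfull ⟩
    ∑[ b ∈ allFin n ] ∑[ a ∈ allFin n ] ⟦ chosen a b ⟧     ≡⟨ ∑-swap (allFin n) (allFin n) _ ⟩
    ∑[ a ∈ allFin n ] # (chosen a)                         ≤⟨ ∑-mono (allFin n) #chosen≤d ⟩
    ∑[ _ ∈ allFin n ] d                                    ≡⟨ ∑-allFin-const n d ⟩
    n * d ∎
    where
    open ≤-Reasoning
    overfull : ∀ b → ⟦ not (indegree b ≤ᵇ Δ) ⟧ * Δ ≤ indegree b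
    overfull b with indegree b ≤ᵇ Δ in h
    ... | true  = z≤n
    ... | false = ≤-trans (≤-reflexive (+-identityʳ Δ)) (<⇒≤ (≰⇒> λ le → subst T h (≤⇒≤ᵇ le)))

  few-damaged : 0 < d → d * 1000 ≤ Δ → 1000 ≤ n → # (not ∘ intact) * 500 ≤ n
  few-damaged 0<d d≤Δ 1000≤n = linear 1 0 (+-mono-≤ 1000≤n (+-mono-≤ (*-monoˡ-≤ 1000 split) overfull))
    (eq n (# (not ∘ intact)) (# (λ b → not (indegree b ≤ᵇ Δ))))
    where
    open ≤-Reasoning
    eq : ∀ n x y → 2 * (x * 500) + (n + ((1 + y) * 1000 + n)) + 0 ≡ 2 * n + (1000 + (x * 1000 + y * 1000))
    eq = solve-∀
    cases : ∀ x y → ⟦ not (not x ∧ y) ⟧ ≤ ⟦ x ⟧ + ⟦ not y ⟧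
    cases true  _     = s≤s z≤n
    cases false true  = z≤n
    cases false false = s≤s z≤n
    split : # (not ∘ intact) ≤ 1 + # (λ b → not (indegree b ≤ᵇ Δ))
    split = begin
      # (not ∘ intact)
        ≤⟨ ∑-mono (allFin n) (λ b → cases (does (b₀ Finₚ.≟ b)) (indegree b ≤ᵇ Δ)) ⟩
      ∑[ b ∈ allFin n ] (⟦ does (b₀ Finₚ.≟ b) ⟧ + ⟦ not (indegree b ≤ᵇ Δ) ⟧)
        ≡⟨ ∑-+ (allFin n) _ _ ⟩
      # (λ b → does (b₀ Finₚ.≟ b)) + # (λ b → not (indegree b ≤ᵇ Δ))
        ≡⟨ cong (_+ # (λ b → not (indegree b ≤ᵇ Δ))) (∑-≟ b₀) ⟩
      1 + # (λ b → not (indegree b ≤ᵇ Δ)) ∎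
    overfull : # (λ b → not (indegree b ≤ᵇ Δ)) * 1000 ≤ n
    overfull = *-cancelʳ-≤ _ _ d {{>-nonZero 0<d}} (begin
      # (λ b → not (indegree b ≤ᵇ Δ)) * 1000 * d     ≡⟨ *-assoc (# (λ b → not (indegree b ≤ᵇ Δ))) 1000 d ⟩
      # (λ b → not (indegree b ≤ᵇ Δ)) * (1000 * d)   ≡⟨ cong (# (λ b → not (indegree b ≤ᵇ Δ)) *_) (*-comm 1000 d) ⟩
      # (λ b → not (indegree b ≤ᵇ Δ)) * (d * 1000)   ≤⟨ *-monoʳ-≤ (# (λ b → not (indegree b ≤ᵇ Δ))) d≤Δ ⟩
      # (λ b → not (indegree b ≤ᵇ Δ)) * Δ            ≤⟨ #overfull ⟩
      n * d ∎)

  #-intact : ∀ (p : Fin n → Bool) → # p ≤ # (λ b → p b ∧ intact b) + # (not ∘ intact)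
  #-intact p = ≤-trans (∑-mono (allFin n) (λ b → cases (p b) (intact b))) (≤-reflexive (∑-+ (allFin n) _ _))
    where
    cases : ∀ x y → ⟦ x ⟧ ≤ ⟦ x ∧ y ⟧ + ⟦ not y ⟧
    cases false _     = z≤n
    cases true  true  = s≤s z≤n
    cases true  false = s≤s z≤n

module Construction
  (q Δ k s : ℕ) {M n : ℕ} (b₀ : Fin n)
  (2≤q : 2 ≤ q) (2≤k : 2 ≤ k) (k≤ : k ≤ 2 ^ q) (κ≤ : suc k ≤ 2 ^ (q * 2))
  (d≤Δ : q * 160000 * 1000 ≤ Δ) (Δ≤n : Δ ≤ n) (1000≤n : 1000 ≤ n)
  {{s≢0 : NonZero s}} (ts≤n : q * 16 * s * 10 ≤ n) (M≤ : M ≤ k * s)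
  where

  0<q : 0 < q
  0<q = <-≤-trans (s≤s z≤n) 2≤q

  instance
    t≢0 : NonZero (q * 16)
    t≢0 = >-nonZero (*-mono-< 0<q (s≤s (z≤n {15})))

  0<d : 0 < q * 160000
  0<d = *-mono-< 0<q (s≤s (z≤n {159999}))

  Conclusion : Set₁
  Conclusion = Σ (Digraph (n + n)) λ D₀ → Σ (Subset (n + n)) λ A → Σ (Subset (n + n)) λ B → Σ (Digraph M) λ R →
    DirectedBipartite D₀ A B × ∣ A ∣ ≡ ∣ B ∣ × ∣ B ∣ ≤ n × maxDegree D₀ ≡ Δ × Tournament R × order R ≡ M ×
    (∀ (A′ B′ : Subset (n + n)) → A′ ⊆ A → B′ ⊆ B →
      (100 * ∣ A′ ∣ ≥ 98 * ∣ A ∣ → 100 * ∣ B′ ∣ ≥ 98 * ∣ A ∣ → ¬ Copy (induced D₀ (A′ ∪ B′)) R) ×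
      (100 * ∣ A′ ∣ ≥ ∣ A ∣ → 100 * ∣ B′ ∣ ≥ ∣ A ∣ → edgesBetween D₀ A′ B′ > 0))

  module Given
    (T : Fin k → Fin k → Bool) (T-antisym : ∀ {p r} → p ≢ r → T r p ≡ not (T p r))
    (sparse : ∀ X Y → ∣ X ∣ ≡ q * 16 → ∣ Y ∣ ≡ q * 16 →
      edges (λ p r → T p r ∨ does (p Finₚ.≟ r)) X Y * 5 < q * 16 * (q * 16) * 4)
    (ω : Fin n → Fin (q * 160000) → Fin n)
    (hit : ∀ f g → n ≤ # (heavy (conflict (λ p r → T p r ∨ does (p Finₚ.≟ r))) f g) * 200 →
      ∃ λ a → ∃ λ i → forbidden (conflict (λ p r → T p r ∨ does (p Finₚ.≟ r))) f g a (ω a i) ≡ true)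
    where

    R : Fin k → Fin k → Bool
    R p r = T p r ∨ does (p Finₚ.≟ r)

    open Truncation ω Δ Δ≤n b₀
    open Bipartite adjacent

    place : Fin M → Fin k × Fin s
    place u = Fin.remQuot s (Fin.inject≤ u M≤)

    place-injective : ∀ {u v} → place u ≡ place v → u ≡ v
    place-injective {u} {v} h = Finₚ.inject≤-injective M≤ M≤ u v (begin
      Fin.inject≤ u M≤                                    ≡⟨ Finₚ.combine-remQuot {k} s (Fin.inject≤ u M≤) ⟨
      Fin.combine (proj₁ (place u)) (proj₂ (place u))      ≡⟨ cong (λ x → Fin.combine (proj₁ x) (proj₂ x)) h ⟩
      Fin.combine (proj₁ (place v)) (proj₂ (place v))      ≡⟨ Finₚ.combine-remQuot {k} s (Fin.inject≤ v M≤) ⟩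
      Fin.inject≤ v M≤                                    ∎)
      where open ≡-Reasoning

    open BlowUp T T-antisym place

    damaged≤ : # (not ∘ intact) * 500 ≤ n
    damaged≤ = few-damaged 0<d d≤Δ 1000≤n

    no-embedding : ∀ (α β : Fin n → Maybe (Fin M)) →
      (∀ {a a′ u} → α a ≡ just u → α a′ ≡ just u → a ≡ a′) →
      (∀ {b b′ u} → β b ≡ just u → β b′ ≡ just u → b ≡ b′) →
      (∀ {b u} → β b ≡ just u → intact b ≡ true) →
      n * 97 ≤ # (Maybe.is-just ∘ α) * 100 → n * 97 ≤ # (Maybe.is-just ∘ β) * 100 →
      (∀ {a b u v} → adjacent a b ≡ true → α a ≡ just u → β b ≡ just v → arrow u v ≡ true) → ⊥
    no-embedding α β α-inj β-inj β-intact many-α many-β embeds =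
      let a , i , conf = hit (labels α) (labels β)
            (heavy-labels R (q * 16) s ts≤n sparse (labels α) (labels β)
              (fibre α α-inj) (fibre β β-inj) (many α many-α) (many β many-β))
      in  clash a i (subst₂ (λ x y → conflict R x y ≡ true)
            (Vecₚ.lookup∘tabulate (label ∘ α) a) (Vecₚ.lookup∘tabulate (label ∘ β) (ω a i)) conf)
      where
      label : Maybe (Fin M) → Fin (suc k)
      label x = part (Maybe.map place x)
      labels : (Fin n → Maybe (Fin M)) → Vec (Fin (suc k)) n
      labels γ = Vec.tabulate (label ∘ γ)
      fibre : ∀ γ → (∀ {a a′ u} → γ a ≡ just u → γ a′ ≡ just u → a ≡ a′) →
        ∀ p → # (λ a → does (lookup (labels γ) a Finₚ.≟ suc p)) ≤ s
      fibre γ inj p = subst (_≤ s)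
        (∑-cong (allFin n) (λ a → cong (λ x → ⟦ does (x Finₚ.≟ suc p) ⟧) (sym (Vecₚ.lookup∘tabulate (label ∘ γ) a))))
        (part-fibre (Maybe.map place ∘ γ) placed-inj p)
        where
        placed : ∀ x {c} → Maybe.map place x ≡ just c → ∃ λ u → x ≡ just u × place u ≡ c
        placed (just u) refl = u , refl , refl
        placed-inj : ∀ {a a′ c} → Maybe.map place (γ a) ≡ just c → Maybe.map place (γ a′) ≡ just c → a ≡ a′
        placed-inj {a} {a′} ha ha′ with placed (γ a) ha | placed (γ a′) ha′
        ... | u , γa , pu | v , γa′ , pv = inj γa (trans γa′ (cong just (place-injective (trans pv (sym pu)))))
      many : ∀ γ → n * 97 ≤ # (Maybe.is-just ∘ γ) * 100 → n * 97 ≤ # (marked ∘ lookup (labels γ)) * 100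
      many γ h = subst (λ x → n * 97 ≤ x * 100) (∑-cong (allFin n) (λ a → cong ⟦_⟧
        (trans (just-marked (γ a)) (cong marked (sym (Vecₚ.lookup∘tabulate (label ∘ γ) a)))))) h
        where
        just-marked : ∀ x → Maybe.is-just x ≡ marked (label x)
        just-marked nothing  = refl
        just-marked (just _) = refl
      clash : ∀ a i → conflict R (label (α a)) (label (β (ω a i))) ≡ true → ⊥
      clash a i conf with α a in αa | β (ω a i) in βb
      ... | just u | just v = contradiction
        (trans (sym conf) (cong not (arrow⇒ u v (embeds (intact-edge a i (β-intact βb)) αa βb)))) λ ()

    no-injection : ∀ {A′ B′} → A′ ⊆ L → B′ ⊆ R′ → 100 * ∣ A′ ∣ ≥ 98 * ∣ L ∣ → 100 * ∣ B′ ∣ ≥ 98 * ∣ L ∣ →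
      (φ : ∀ u → u ∈ L ∪ R′ → u ∈ A′ ∪ B′ → Fin M) →
      (∀ {u v} u∈V u∈S v∈V v∈S → φ u u∈V u∈S ≡ φ v v∈V v∈S → u ≡ v) →
      (∀ {u v} u∈V u∈S v∈V v∈S → E bipartite u v → arrow (φ u u∈V u∈S) (φ v v∈V v∈S) ≡ true) → ⊥
    no-injection {A′} {B′} A′⊆L B′⊆R large-A large-B φ φ-injective φ-edge =
      no-embedding α β α-inj β-inj β-intact many-α many-β embeds
      where
      inA inB : Fin n → Bool
      inA a = lookup A′ (a Fin.↑ˡ n)
      inB b = lookup B′ (n Fin.↑ʳ b) ∧ intact b
      a∈S : ∀ {a} → inA a ≡ true → a Fin.↑ˡ n ∈ A′ ∪ B′
      a∈S h = x∈p∪q⁺ (inj₁ (lookup⇒∈ h))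
      b∈S : ∀ {b} → inB b ≡ true → n Fin.↑ʳ b ∈ A′ ∪ B′
      b∈S {b} h = x∈p∪q⁺ (inj₂ (lookup⇒∈ (proj₁ (∧-true {lookup B′ (n Fin.↑ʳ b)} h))))
      a∈V : ∀ {a} → a Fin.↑ˡ n ∈ L ∪ R′
      a∈V {a} = x∈p∪q⁺ (inj₁ (∈L a))
      b∈V : ∀ {b} → n Fin.↑ʳ b ∈ L ∪ R′
      b∈V {b} = x∈p∪q⁺ (inj₂ (∈R b))
      imageA : ∀ a → inA a ≡ true → Fin M
      imageA a h = φ (a Fin.↑ˡ n) a∈V (a∈S h)
      imageB : ∀ b → inB b ≡ true → Fin M
      imageB b h = φ (n Fin.↑ʳ b) b∈V (b∈S h)
      when : ∀ x → (x ≡ true → Fin M) → Maybe (Fin M)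
      when true  h = just (h refl)
      when false _ = nothing
      when⇒ : ∀ x h {u} → when x h ≡ just u → ∃ λ e → h e ≡ u
      when⇒ true h refl = refl , refl
      when-just : ∀ x h → Maybe.is-just (when x h) ≡ x
      when-just true  _ = refl
      when-just false _ = refl
      α β : Fin n → Maybe (Fin M)
      α a = when (inA a) (imageA a)
      β b = when (inB b) (imageB b)
      α-inj : ∀ {a a′ u} → α a ≡ just u → α a′ ≡ just u → a ≡ a′
      α-inj {a} {a′} h h′ =
        let a∈  , e  = when⇒ (inA a) (imageA a) h
            a′∈ , e′ = when⇒ (inA a′) (imageA a′) h′
        in  Finₚ.↑ˡ-injective n a a′ (φ-injective a∈V (a∈S a∈) a∈V (a∈S a′∈) (trans e (sym e′)))
      β-inj : ∀ {b b′ u} → β b ≡ just u → β b′ ≡ just u → b ≡ b′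
      β-inj {b} {b′} h h′ =
        let b∈  , e  = when⇒ (inB b) (imageB b) h
            b′∈ , e′ = when⇒ (inB b′) (imageB b′) h′
        in  Finₚ.↑ʳ-injective n b b′ (φ-injective b∈V (b∈S b∈) b∈V (b∈S b′∈) (trans e (sym e′)))
      β-intact : ∀ {b u} → β b ≡ just u → intact b ≡ true
      β-intact {b} h = proj₂ (∧-true {lookup B′ (n Fin.↑ʳ b)} (proj₁ (when⇒ (inB b) (imageB b) h)))
      embeds : ∀ {a b u v} → adjacent a b ≡ true → α a ≡ just u → β b ≡ just v → arrow u v ≡ true
      embeds {a} {b} ab ha hb =
        let a∈ , e  = when⇒ (inA a) (imageA a) ha
            b∈ , e′ = when⇒ (inB b) (imageB b) hb
        in  subst₂ (λ u v → arrow u v ≡ true) e e′ (φ-edge a∈V (a∈S a∈) b∈V (b∈S b∈) (trans (incident-LR a b) ab))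
      #inA : # inA ≡ ∣ A′ ∣
      #inA = sym (∣S∣-L A′⊆L)
      many-α : n * 97 ≤ # (Maybe.is-just ∘ α) * 100
      many-α = subst (λ x → n * 97 ≤ x * 100) (trans (sym #inA) (∑-cong (allFin n) (λ a → cong ⟦_⟧ (sym (when-just (inA a) (imageA a))))))
        (linear 0 n (subst (λ x → 98 * x ≤ 100 * ∣ A′ ∣) ∣L∣≡n large-A) (eq n ∣ A′ ∣))
        where
        eq : ∀ n x → 1 * (n * 97) + 100 * x + n ≡ 1 * (x * 100) + 98 * n
        eq = solve-∀
      many-β : n * 97 ≤ # (Maybe.is-just ∘ β) * 100
      many-β = subst (λ x → n * 97 ≤ x * 100) (∑-cong (allFin n) (λ b → cong ⟦_⟧ (sym (when-just (inB b) (imageB b)))))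
        (linear 4 (n * 4) (+-mono-≤ (*-monoʳ-≤ 5 (subst (λ x → 98 * x ≤ 100 * ∣ B′ ∣) ∣L∣≡n large-B))
          (+-mono-≤ damaged≤ (*-monoʳ-≤ 500 (subst (_≤ # inB + # (not ∘ intact)) (sym (∣S∣-R B′⊆R))
            (#-intact (λ b → lookup B′ (n Fin.↑ʳ b)))))))
          (eq n ∣ B′ ∣ (# inB) (# (not ∘ intact))))
        where
        eq : ∀ n x y z → 5 * (n * 97) + (5 * (100 * x) + (n + 500 * (y + z))) + n * 4
          ≡ 5 * (y * 100) + (5 * (98 * n) + (z * 500 + 500 * x))
        eq = solve-∀

    no-copy : ∀ A′ B′ → A′ ⊆ L → B′ ⊆ R′ → 100 * ∣ A′ ∣ ≥ 98 * ∣ L ∣ → 100 * ∣ B′ ∣ ≥ 98 * ∣ L ∣ →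
      ¬ Copy (induced bipartite (A′ ∪ B′)) blow-up
    no-copy A′ B′ A′⊆L B′⊆R large-A large-B copy =
      let φ , φ-injective , φ-edge = copy-map bipartite (A′ ∪ B′) blow-up copy
      in  no-injection A′⊆L B′⊆R large-A large-B φ φ-injective φ-edge

    p₀ p₁ : Fin k
    p₀ = Fin.fromℕ< (<-≤-trans (s≤s z≤n) 2≤k)
    p₁ = Fin.fromℕ< 2≤k

    unrelated : ∃ λ p → ∃ λ r → R p r ≡ false
    unrelated = cases (T p₀ p₁) (T p₁ p₀) refl refl (T-antisym p₀≢p₁)
      where
      p₀≢p₁ : p₀ ≢ p₁
      p₀≢p₁ h with () ← trans (sym (Finₚ.toℕ-fromℕ< (<-≤-trans (s≤s z≤n) 2≤k))) (trans (cong toℕ h) (Finₚ.toℕ-fromℕ< 2≤k))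
      cases : ∀ x y → T p₀ p₁ ≡ x → T p₁ p₀ ≡ y → T p₁ p₀ ≡ not (T p₀ p₁) → ∃ λ p → ∃ λ r → R p r ≡ false
      cases false _ h _ _ = p₀ , p₁ , cong₂ _∨_ h (dec-false (p₀ Finₚ.≟ p₁) p₀≢p₁)
      cases true  _ h _ h′ = p₁ , p₀ , cong₂ _∨_ (trans h′ (cong not h)) (dec-false (p₁ Finₚ.≟ p₀) (p₀≢p₁ ∘ sym))

    -- All of A′ is labelled p and all of B′ is labelled r, where p may not precede r.
    edges-exist : ∀ A′ B′ → A′ ⊆ L → B′ ⊆ R′ → 100 * ∣ A′ ∣ ≥ ∣ L ∣ → 100 * ∣ B′ ∣ ≥ ∣ L ∣ →
      edgesBetween bipartite A′ B′ > 0
    edges-exist A′ B′ A′⊆L B′⊆R large-A large-B =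
      let a , i , conf = hit f g many-heavy
          a∈ , b∈ = conflict⇒ (inA a) (inB (ω a i))
            (subst₂ (λ x y → conflict R x y ≡ true)
              (Vecₚ.lookup∘tabulate (mark p ∘ inA) a) (Vecₚ.lookup∘tabulate (mark r ∘ inB) (ω a i)) conf)
          b∈B′ , b-intact = ∧-true {lookup B′ (n Fin.↑ʳ ω a i)} b∈
      in  edge⇒edgesBetween bipartite {A′} {B′} {a Fin.↑ˡ n} {n Fin.↑ʳ ω a i} (lookup⇒∈ a∈) (lookup⇒∈ b∈B′)
            (trans (incident-LR a (ω a i)) (intact-edge a i b-intact))
      where
      p r : Fin k
      p = proj₁ unrelated
      r = proj₁ (proj₂ unrelated)
      mark : Fin k → Bool → Fin (suc k)
      mark p true  = suc p
      mark p false = zero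
      inA inB : Fin n → Bool
      inA a = lookup A′ (a Fin.↑ˡ n)
      inB b = lookup B′ (n Fin.↑ʳ b) ∧ intact b
      f g : Vec (Fin (suc k)) n
      f = Vec.tabulate (mark p ∘ inA)
      g = Vec.tabulate (mark r ∘ inB)
      conflict⇒ : ∀ x y → conflict R (mark p x) (mark r y) ≡ true → x ≡ true × y ≡ true
      conflict⇒ true true _ = refl , refl
      conflict-mark : ∀ y → y ≡ conflict R (mark p true) (mark r y)
      conflict-mark true  = cong not (sym (proj₂ (proj₂ unrelated)))
      conflict-mark false = refl
      large-inB : n ≤ # inB * 200
      large-inB = linear 4 (n * 3) (+-mono-≤ (*-monoʳ-≤ 10 (subst (_≤ 100 * ∣ B′ ∣) ∣L∣≡n large-B))
          (+-mono-≤ (*-monoˡ-≤ 2 damaged≤) (*-monoʳ-≤ 1000 (subst (_≤ # inB + # (not ∘ intact)) (sym (∣S∣-R B′⊆R))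
            (#-intact (λ b → lookup B′ (n Fin.↑ʳ b)))))))
          (eq n ∣ B′ ∣ (# inB) (# (not ∘ intact)))
        where
        eq : ∀ n x y z → 5 * n + (10 * (100 * x) + (n * 2 + 1000 * (y + z))) + n * 3
          ≡ 5 * (y * 200) + (10 * n + (z * 500 * 2 + 1000 * x))
        eq = solve-∀
      A-heavy : ∀ a → inA a ≡ true → heavy (conflict R) f g a ≡ true
      A-heavy a a∈ = ≡-T (≤⇒≤ᵇ (subst (λ x → n ≤ x * 200) (∑-cong (allFin n) (λ b → cong ⟦_⟧
        (trans (conflict-mark (inB b)) (cong₂ (conflict R)
          (trans (cong (mark p) (sym a∈)) (sym (Vecₚ.lookup∘tabulate (mark p ∘ inA) a)))
          (sym (Vecₚ.lookup∘tabulate (mark r ∘ inB) b)))))) large-inB))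
      many-heavy : n ≤ # (heavy (conflict R) f g) * 200
      many-heavy = begin
        n                                  ≤⟨ subst (_≤ 100 * ∣ A′ ∣) ∣L∣≡n large-A ⟩
        100 * ∣ A′ ∣                       ≤⟨ *-monoˡ-≤ ∣ A′ ∣ (m≤m+n 100 100) ⟩
        200 * ∣ A′ ∣                       ≡⟨ *-comm 200 ∣ A′ ∣ ⟩
        ∣ A′ ∣ * 200                       ≡⟨ cong (_* 200) (∣S∣-L A′⊆L) ⟩
        # inA * 200                        ≤⟨ *-monoˡ-≤ 200 (#-mono A-heavy) ⟩
        # (heavy (conflict R) f g) * 200   ∎
        where open ≤-Reasoning

    conclusion : Conclusion
    conclusion = bipartite , L , R′ , blow-up , bipartite-directed , trans ∣L∣≡n (sym ∣R∣≡n) , ≤-reflexive ∣R∣≡n ,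
      maxDegree≡ b₀ (rows d<Δ) columns b₀-full , blow-up-tournament , ∣⊤∣≡n M ,
      λ A′ B′ A′⊆ B′⊆ → no-copy A′ B′ A′⊆ B′⊆ , edges-exist A′ B′ A′⊆ B′⊆
      where
      d<Δ : suc (q * 160000) ≤ Δ
      d<Δ = ≤-trans (linear 0 (q * 160000 * 998) 0<d (eq (q * 160000))) d≤Δ
        where
        eq : ∀ d → 1 * suc d + d + d * 998 ≡ 1 * (d * 1000) + 1
        eq = solve-∀

  construction : Conclusion
  construction =
    let T , T-antisym , sparse = sparse-tournament q 2≤q k≤
        ω , hit = random-graph (conflict (λ p r → T p r ∨ does (p Finₚ.≟ r))) q 0<q (≤-trans (s≤s z≤n) 1000≤n) κ≤
    in  Given.conclusion T T-antisym sparse ω hit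

-- The choice of the parameters

-- Bernoulli's inequality for (1 - 1/(N+1))^j, cleared of denominators.
bernoulli : ∀ N j {r} → j + r ≡ suc N → suc N ^ j * r ≤ N ^ j * suc N
bernoulli N zero    {r} refl = ≤-refl
bernoulli N (suc j) {r} h with refl ← suc-injective h = begin
  suc N * suc N ^ j * r        ≡⟨ regroup₁ (suc N) (suc N ^ j) r ⟩
  suc N ^ j * (suc N * r)      ≤⟨ *-monoʳ-≤ (suc N ^ j) (linear 0 j ≤-refl (eq j r)) ⟩
  suc N ^ j * (N * suc r)      ≡⟨ regroup₂ N (suc N ^ j) (suc r) ⟩
  N * (suc N ^ j * suc r)      ≤⟨ *-monoʳ-≤ N (bernoulli N j (+-suc j r)) ⟩
  N * (N ^ j * suc N)          ≡⟨ *-assoc N (N ^ j) (suc N) ⟨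
  N * N ^ j * suc N            ∎
  where
  open ≤-Reasoning
  regroup₁ : ∀ a b c → a * b * c ≡ b * (a * c)
  regroup₁ = solve-∀
  regroup₂ : ∀ a b c → b * (a * c) ≡ a * (b * c)
  regroup₂ = solve-∀
  eq : ∀ j r → 1 * (suc (j + r) * r) + 0 + j ≡ 1 * ((j + r) * suc r) + 0
  eq = solve-∀

halving : ∀ N j → suc N ≡ j * 2 → suc N ^ j ≤ N ^ j * 2
halving N (suc j) h = *-cancelʳ-≤ _ _ (suc j) (begin
  suc N ^ suc j * suc j        ≤⟨ bernoulli N (suc j) (trans (eq (suc j)) (sym h)) ⟩
  N ^ suc j * suc N            ≡⟨ cong (N ^ suc j *_) (trans h (*-comm (suc j) 2)) ⟩
  N ^ suc j * (2 * suc j)      ≡⟨ *-assoc (N ^ suc j) 2 (suc j) ⟨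
  N ^ suc j * 2 * suc j        ∎)
  where
  open ≤-Reasoning
  eq : ∀ j → j + j ≡ j * 2
  eq = solve-∀

growth : ∀ N j m e → suc N ≡ j * 2 → e ≤ j * m → suc N ^ e ≤ N ^ e * 2 ^ m
growth zero       j m e h e≤ = contradiction h (odd j)
  where
  odd : ∀ j → 1 ≢ j * 2
  odd zero    ()
  odd (suc j) ()
growth N@(suc _) j m e h e≤ with j * m ∸ e | m+[n∸m]≡n e≤
... | r | eq = *-cancelʳ-≤ _ _ (N ^ r) {{m^n≢0 N r}} (begin
  suc N ^ e * N ^ r            ≤⟨ *-monoʳ-≤ (suc N ^ e) (^-monoˡ-≤ r (n≤1+n N)) ⟩
  suc N ^ e * suc N ^ r        ≡⟨ ^-distribˡ-+-* (suc N) e r ⟨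
  suc N ^ (e + r)              ≡⟨ cong (suc N ^_) eq ⟩
  suc N ^ (j * m)              ≡⟨ ^-*-assoc (suc N) j m ⟨
  (suc N ^ j) ^ m              ≤⟨ ^-monoˡ-≤ m (halving N j h) ⟩
  (N ^ j * 2) ^ m              ≡⟨ ^-distribʳ-* (N ^ j) 2 m ⟩
  (N ^ j) ^ m * 2 ^ m          ≡⟨ cong (_* 2 ^ m) (trans (^-*-assoc N j m) (trans (cong (N ^_) (sym eq)) (^-distribˡ-+-* N e r))) ⟩
  N ^ e * N ^ r * 2 ^ m        ≡⟨ regroup (N ^ e) (N ^ r) (2 ^ m) ⟩
  N ^ e * 2 ^ m * N ^ r        ∎)
  where
  open ≤-Reasoning
  regroup : ∀ a b c → a * b * c ≡ a * c * b
  regroup = solve-∀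

linear≤2^-+ : ∀ c e m → 0 < e → c * e ≤ 2 ^ e → c * (e + m) ≤ 2 ^ (e + m)
linear≤2^-+ c e zero    0<e h = subst (λ x → c * x ≤ 2 ^ x) (sym (+-identityʳ e)) h
linear≤2^-+ c e (suc m) 0<e h = begin
  c * (e + suc m)      ≤⟨ linear 0 (c * m) (*-monoʳ-≤ c 0<e) (eq c e m) ⟩
  2 * (c * (e + m))    ≤⟨ *-monoʳ-≤ 2 (linear≤2^-+ c e m 0<e h) ⟩
  2 ^ suc (e + m)      ≡⟨ cong (2 ^_) (+-suc e m) ⟨
  2 ^ (e + suc m)      ∎
  where
  open ≤-Reasoning
  eq : ∀ c e m → 1 * (c * (e + suc m)) + c * e + c * m ≡ 1 * (2 * (c * (e + m))) + c * 1
  eq = solve-∀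

linear≤2^ : ∀ c {e m} → 0 < e → e ≤ m → c * e ≤ 2 ^ e → c * m ≤ 2 ^ m
linear≤2^ c {e} {m} 0<e e≤m h = subst (λ x → c * x ≤ 2 ^ x) (m+[n∸m]≡n e≤m) (linear≤2^-+ c e (m ∸ e) 0<e h)

Fraction : ℚ → ℕ → ℕ → Set
Fraction p a b = ℚ.↥ p ℤ.* ℤ.+ b ≡ ℤ.+ a ℤ.* ℚ.↧ p

fraction-/ : ∀ a b .{{_ : NonZero b}} → Fraction (ℤ.+ a ℚ./ b) a b
fraction-/ a b = begin
  ℚ.↥ p ℤ.* ℤ.+ b           ≡⟨ cong (ℚ.↥ p ℤ.*_) (ℚₚ.↧-/ (ℤ.+ a) b) ⟨
  ℚ.↥ p ℤ.* (ℚ.↧ p ℤ.* g)   ≡⟨ regroup (ℚ.↥ p) (ℚ.↧ p) g ⟩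
  ℚ.↥ p ℤ.* g ℤ.* ℚ.↧ p     ≡⟨ cong (ℤ._* ℚ.↧ p) (ℚₚ.↥-/ (ℤ.+ a) b) ⟩
  ℤ.+ a ℤ.* ℚ.↧ p           ∎
  where
  open ≡-Reasoning
  p = ℤ.+ a ℚ./ b
  g = gcd (ℤ.+ a) (ℤ.+ b)
  regroup : ∀ x y z → x ℤ.* (y ℤ.* z) ≡ x ℤ.* z ℤ.* y
  regroup = ℤ-solve-∀

fraction-* : ∀ p q {a b c d} → Fraction p a b → Fraction q c d → Fraction (p ℚ.* q) (a * c) (b * d)
fraction-* p@record{} q@record{} {a} {b} {c} {d} hp hq = ℤₚ.*-cancelʳ-≡ _ _ (ℚ.↧ p ℤ.* ℚ.↧ q) (begin
  ℚ.↥ r ℤ.* ℤ.+ (b * d) ℤ.* (ℚ.↧ p ℤ.* ℚ.↧ q)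
    ≡⟨ cong (λ x → ℚ.↥ r ℤ.* x ℤ.* (ℚ.↧ p ℤ.* ℚ.↧ q)) (ℤₚ.pos-* b d) ⟩
  ℚ.↥ r ℤ.* (ℤ.+ b ℤ.* ℤ.+ d) ℤ.* (ℚ.↧ p ℤ.* ℚ.↧ q)
    ≡⟨ regroup₁ (ℚ.↥ r) (ℤ.+ b) (ℤ.+ d) (ℚ.↧ p ℤ.* ℚ.↧ q) ⟩
  ℚ.↥ r ℤ.* (ℚ.↧ p ℤ.* ℚ.↧ q) ℤ.* (ℤ.+ b ℤ.* ℤ.+ d)
    ≡⟨ cong (ℤ._* (ℤ.+ b ℤ.* ℤ.+ d)) cross ⟩
  ℚ.↥ p ℤ.* ℚ.↥ q ℤ.* ℚ.↧ r ℤ.* (ℤ.+ b ℤ.* ℤ.+ d)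
    ≡⟨ regroup₂ (ℚ.↥ p) (ℚ.↥ q) (ℚ.↧ r) (ℤ.+ b) (ℤ.+ d) ⟩
  (ℚ.↥ p ℤ.* ℤ.+ b) ℤ.* (ℚ.↥ q ℤ.* ℤ.+ d) ℤ.* ℚ.↧ r
    ≡⟨ cong₂ (λ x y → x ℤ.* y ℤ.* ℚ.↧ r) hp hq ⟩
  (ℤ.+ a ℤ.* ℚ.↧ p) ℤ.* (ℤ.+ c ℤ.* ℚ.↧ q) ℤ.* ℚ.↧ r
    ≡⟨ regroup₃ (ℤ.+ a) (ℤ.+ c) (ℚ.↧ p) (ℚ.↧ q) (ℚ.↧ r) ⟩
  (ℤ.+ a ℤ.* ℤ.+ c) ℤ.* ℚ.↧ r ℤ.* (ℚ.↧ p ℤ.* ℚ.↧ q)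
    ≡⟨ cong (λ x → x ℤ.* ℚ.↧ r ℤ.* (ℚ.↧ p ℤ.* ℚ.↧ q)) (ℤₚ.pos-* a c) ⟨
  ℤ.+ (a * c) ℤ.* ℚ.↧ r ℤ.* (ℚ.↧ p ℤ.* ℚ.↧ q) ∎)
  where
  open ≡-Reasoning
  r = p ℚ.* q
  g = gcd (ℚ.↥ p ℤ.* ℚ.↥ q) (ℚ.↧ p ℤ.* ℚ.↧ q)
  cross : ℚ.↥ r ℤ.* (ℚ.↧ p ℤ.* ℚ.↧ q) ≡ ℚ.↥ p ℤ.* ℚ.↥ q ℤ.* ℚ.↧ r
  cross = begin
    ℚ.↥ r ℤ.* (ℚ.↧ p ℤ.* ℚ.↧ q)          ≡⟨ cong (ℚ.↥ r ℤ.*_) (ℚₚ.↧-* p q) ⟨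
    ℚ.↥ r ℤ.* (ℚ.↧ r ℤ.* g)    ≡⟨ regroup₀ (ℚ.↥ r) (ℚ.↧ r) (g) ⟩
    ℚ.↥ r ℤ.* g ℤ.* ℚ.↧ r      ≡⟨ cong (ℤ._* ℚ.↧ r) (ℚₚ.↥-* p q) ⟩
    ℚ.↥ p ℤ.* ℚ.↥ q ℤ.* ℚ.↧ r            ∎
    where
    regroup₀ : ∀ x y z → x ℤ.* (y ℤ.* z) ≡ x ℤ.* z ℤ.* y
    regroup₀ = ℤ-solve-∀
  regroup₁ : ∀ w x y z → w ℤ.* (x ℤ.* y) ℤ.* z ≡ w ℤ.* z ℤ.* (x ℤ.* y)
  regroup₁ = ℤ-solve-∀
  regroup₂ : ∀ v w x y z → v ℤ.* w ℤ.* x ℤ.* (y ℤ.* z) ≡ (v ℤ.* y) ℤ.* (w ℤ.* z) ℤ.* x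
  regroup₂ = ℤ-solve-∀
  regroup₃ : ∀ v w x y z → (v ℤ.* x) ℤ.* (w ℤ.* y) ℤ.* z ≡ (v ℤ.* w) ℤ.* z ℤ.* (x ℤ.* y)
  regroup₃ = ℤ-solve-∀

fraction-^ : ∀ p {a b} → Fraction p a b → ∀ e → Fraction (p ^ℚ e) (a ^ e) (b ^ e)
fraction-^ p h zero    = refl
fraction-^ p {a} {b} h (suc e) = fraction-* p (p ^ℚ e) {a} {b} {a ^ e} {b ^ e} h (fraction-^ p h e)

fraction-floor : ∀ p {a b c} → 0 < b → Fraction p a b → a ≤ b * c → ∃ λ m → ℤ.+ m ≡ floor p × m ≤ c
fraction-floor (ℚ.mkℚ (ℤ.+ u) d _) {a} {b} {c} 0<b h a≤bc = u / suc d , sym (ℤₚ.*-identityˡ (ℤ.+ (u / suc d))) , *-cancelʳ-≤ _ _ (suc d) (begin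
  u / suc d * suc d  ≤⟨ m/n*n≤m u (suc d) ⟩
  u                  ≤⟨ *-cancelʳ-≤ u (c * suc d) b {{>-nonZero 0<b}} ub≤ ⟩
  c * suc d          ∎)
  where
  open ≤-Reasoning
  ub≡ : u * b ≡ a * suc d
  ub≡ = ℤₚ.+-injective (trans (ℤₚ.pos-* u b) (trans h (sym (ℤₚ.pos-* a (suc d)))))
  ub≤ : u * b ≤ c * suc d * b
  ub≤ = begin
    u * b              ≡⟨ ub≡ ⟩
    a * suc d          ≤⟨ *-monoˡ-≤ (suc d) a≤bc ⟩
    b * c * suc d      ≡⟨ regroup b c (suc d) ⟩
    c * suc d * b      ∎
    where
    regroup : ∀ x y z → x * y * z ≡ y * z * x
    regroup = solve-∀
fraction-floor (ℚ.mkℚ ℤ.-[1+ u ] d _) {a} {suc b} 0<b h _ with () ← trans h (sym (ℤₚ.pos-* a (suc d)))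

fraction->1 : ∀ p N → 0 < N → Fraction p (suc N) N → p ℚ.> 1ℚ
fraction->1 (ℚ.mkℚ (ℤ.+ u) d _) N 0<N h = ℚ.*<* (subst₂ ℤ._<_ (sym (ℤₚ.*-identityˡ (ℤ.+ suc d)))
  (sym (ℤₚ.*-identityʳ (ℤ.+ u))) (ℤ.+<+ (≰⇒> λ u≤ → <⇒≱ (*-monoˡ-< (suc d) (n<1+n N)) (begin
    suc N * suc d   ≡⟨ uN≡ ⟨
    u * N           ≤⟨ *-monoˡ-≤ N u≤ ⟩
    suc d * N       ≡⟨ *-comm (suc d) N ⟩
    N * suc d       ∎))))
  where
  open ≤-Reasoning
  uN≡ : u * N ≡ suc N * suc d
  uN≡ = ℤₚ.+-injective (trans (ℤₚ.pos-* u N) (trans h (sym (ℤₚ.pos-* (suc N) (suc d)))))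
fraction->1 (ℚ.mkℚ ℤ.-[1+ u ] d _) (suc N) 0<N h with () ← h

m<[1+m/n]*n : ∀ m n .{{_ : NonZero n}} → m < suc (m / n) * n
m<[1+m/n]*n m n = subst (_< suc (m / n) * n) (sym (m≡m%n+[m/n]*n m n)) (+-monoˡ-< (m / n * n) (m%n<n m n))

*≤⇒≤/ : ∀ {m n o} .{{_ : NonZero n}} → m * n ≤ o → m ≤ o / n
*≤⇒≤/ {m} {n} {o} h = subst (_≤ o / n) (m*n/n≡m m n) (/-monoˡ-≤ n h)

-- The tournament T has 2^(2⌊Δ/κ⌋) vertices, each replaced by a part of ⌊n/Δ⌋ vertices.
module Parameters (κ N : ℕ) .{{_ : NonZero κ}} .{{_ : NonZero N}} (κ≡ : κ ≡ 320000000) (N≡ : suc N ≡ κ * 2 * 2)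
                  (κ-small : κ * 4 * 40 ≤ 2 ^ 40) (Δ n : ℕ) (Δ≥ : 40 * κ ≤ Δ) (Δ≤n : Δ ≤ n) where

  open ≤-Reasoning

  μ q : ℕ
  μ = Δ / κ
  q = μ * 2

  μκ≤Δ : μ * κ ≤ Δ
  μκ≤Δ = m/n*n≤m Δ κ

  40≤μ : 40 ≤ μ
  40≤μ = *≤⇒≤/ {40} {κ} Δ≥

  0<μ : 0 < μ
  0<μ = ≤-trans (s≤s z≤n) 40≤μ

  0<Δ : 0 < Δ
  0<Δ = <-≤-trans (*-mono-< {0} {40} {0} {κ} (s≤s z≤n) (>-nonZero⁻¹ κ)) Δ≥

  instance
    Δ≢0 : NonZero Δ
    Δ≢0 = >-nonZero 0<Δ

  s : ℕ
  s = n / Δ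

  1≤s : 1 ≤ s
  1≤s = *≤⇒≤/ {1} {Δ} (≤-trans (≤-reflexive (*-identityˡ Δ)) Δ≤n)

  sΔ≤n : s * Δ ≤ n
  sΔ≤n = m/n*n≤m n Δ

  κ* : ∀ x → x * 320000000 ≡ x * κ
  κ* x = cong (x *_) (sym κ≡)

  2≤q : 2 ≤ q
  2≤q = *-monoˡ-≤ 2 0<μ

  2≤2^q : 2 ≤ 2 ^ q
  2≤2^q = ^-monoʳ-≤ 2 (≤-trans (s≤s z≤n) 2≤q)

  labels≤ : suc (2 ^ q) ≤ 2 ^ (q * 2)
  labels≤ = begin
    1 + 2 ^ q            ≤⟨ +-monoˡ-≤ (2 ^ q) (≤-trans (s≤s z≤n) 2≤2^q) ⟩
    2 ^ q + 2 ^ q        ≡⟨ cong (2 ^ q +_) (+-identityʳ (2 ^ q)) ⟨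
    2 * 2 ^ q            ≤⟨ *-monoˡ-≤ (2 ^ q) 2≤2^q ⟩
    2 ^ q * 2 ^ q        ≡⟨ ^-distribˡ-+-* 2 q q ⟨
    2 ^ (q + q)          ≡⟨ cong (2 ^_) (double q) ⟩
    2 ^ (q * 2)          ∎
    where
    double : ∀ q → q + q ≡ q * 2
    double = solve-∀

  degree≤ : q * 160000 * 1000 ≤ Δ
  degree≤ = begin
    μ * 2 * 160000 * 1000   ≡⟨ trans (*-assoc (μ * 2) 160000 1000) (*-assoc μ 2 160000000) ⟩
    μ * 320000000           ≡⟨ κ* μ ⟩
    μ * κ                   ≤⟨ μκ≤Δ ⟩
    Δ                       ∎

  1000≤n : 1000 ≤ n
  1000≤n = begin
    1000             ≤⟨ toWitness {a? = 1000 ≤? 320000000} _ ⟩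
    320000000        ≡⟨ κ≡ ⟨
    κ                ≤⟨ m≤m+n κ (39 * κ) ⟩
    40 * κ           ≤⟨ Δ≥ ⟩
    Δ                ≤⟨ Δ≤n ⟩
    n                ∎

  parts≤ : q * 16 * s * 10 ≤ n
  parts≤ = begin
    μ * 2 * 16 * s * 10     ≡⟨ regroup μ s ⟩
    s * (μ * 320)           ≤⟨ *-monoʳ-≤ s (*-monoʳ-≤ μ (≤-trans (toWitness {a? = 320 ≤? 320000000} _) (≤-reflexive (sym κ≡)))) ⟩
    s * (μ * κ)             ≤⟨ *-monoʳ-≤ s μκ≤Δ ⟩
    s * Δ                   ≤⟨ sΔ≤n ⟩
    n                       ∎
    where
    regroup : ∀ μ s → μ * 2 * 16 * s * 10 ≡ s * (μ * 320)
    regroup = solve-∀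

  Δ≤2κμ : Δ ≤ κ * 2 * μ
  Δ≤2κμ = begin
    Δ                ≤⟨ <⇒≤ (m<[1+m/n]*n Δ κ) ⟩
    suc μ * κ        ≤⟨ *-monoˡ-≤ κ (+-monoˡ-≤ μ 0<μ) ⟩
    (μ + μ) * κ      ≡⟨ regroup μ κ ⟩
    κ * 2 * μ        ∎
    where
    regroup : ∀ μ κ → (μ + μ) * κ ≡ κ * 2 * μ
    regroup = solve-∀

  2Δ≤2^μ : Δ * 2 ≤ 2 ^ μ
  2Δ≤2^μ = begin
    Δ * 2                       ≤⟨ *-monoˡ-≤ 2 Δ≤2κμ ⟩
    κ * 2 * μ * 2               ≡⟨ regroup κ μ ⟩
    κ * 4 * μ                   ≤⟨ linear≤2^ (κ * 4) (s≤s z≤n) 40≤μ κ-small ⟩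
    2 ^ μ                       ∎
    where
    regroup : ∀ κ μ → κ * 2 * μ * 2 ≡ κ * 4 * μ
    regroup = solve-∀

  n≤2^μs : n ≤ 2 ^ μ * s
  n≤2^μs = begin
    n                ≤⟨ <⇒≤ (m<[1+m/n]*n n Δ) ⟩
    suc s * Δ        ≤⟨ *-monoˡ-≤ Δ (+-monoˡ-≤ s 1≤s) ⟩
    (s + s) * Δ      ≡⟨ regroup s Δ ⟩
    Δ * 2 * s        ≤⟨ *-monoˡ-≤ s 2Δ≤2^μ ⟩
    2 ^ μ * s        ∎
    where
    regroup : ∀ s Δ → (s + s) * Δ ≡ Δ * 2 * s
    regroup = solve-∀

  base : ℚ
  base = ℤ.+ suc N ℚ./ N

  base-^-* : Fraction (base ^ℚ Δ ℚ.* fromℕ n) (suc N ^ Δ * n) (N ^ Δ * 1)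
  base-^-* = fraction-* (base ^ℚ Δ) (fromℕ n) {suc N ^ Δ} {N ^ Δ} {n} {1}
    (fraction-^ base {suc N} {N} (fraction-/ (suc N) N) Δ) (fraction-/ n 1)

  tournament≤ : suc N ^ Δ * n ≤ N ^ Δ * 1 * (2 ^ q * s)
  tournament≤ = begin
    suc N ^ Δ * n                       ≤⟨ *-mono-≤ (growth N (κ * 2) μ Δ N≡ Δ≤2κμ) n≤2^μs ⟩
    N ^ Δ * 2 ^ μ * (2 ^ μ * s)         ≡⟨ regroup (N ^ Δ) (2 ^ μ) s ⟩
    N ^ Δ * 1 * (2 ^ μ * 2 ^ μ * s)     ≡⟨ cong (λ x → N ^ Δ * 1 * (x * s)) (trans (sym (^-distribˡ-+-* 2 μ μ)) (cong (2 ^_) (double μ))) ⟩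
    N ^ Δ * 1 * (2 ^ q * s)             ∎
    where
    regroup : ∀ a b c → a * b * (b * c) ≡ a * 1 * (b * b * c)
    regroup = solve-∀
    double : ∀ μ → μ + μ ≡ μ * 2
    double = solve-∀

  order-R : ∃ λ M → ℤ.+ M ≡ floor (base ^ℚ Δ ℚ.* fromℕ n) × M ≤ 2 ^ q * s
  order-R = fraction-floor (base ^ℚ Δ ℚ.* fromℕ n) {suc N ^ Δ * n} {N ^ Δ * 1} {2 ^ q * s}
    (*-mono-< {0} {N ^ Δ} {0} {1} (m^n>0 N Δ) (s≤s z≤n)) base-^-* tournament≤

  result : Σ ℕ λ N′ → Σ (Digraph N′) λ D₀ → Σ (Subset N′) λ A → Σ (Subset N′) λ B → Σ ℕ λ M → Σ (Digraph M) λ R →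
    DirectedBipartite D₀ A B × ∣ A ∣ ≡ ∣ B ∣ × ∣ B ∣ ≤ n × maxDegree D₀ ≡ Δ × Tournament R ×
    ℤ.+ order R ≡ floor (base ^ℚ Δ ℚ.* fromℕ n) ×
    (∀ (A′ B′ : Subset N′) → A′ ⊆ A → B′ ⊆ B →
      (100 * ∣ A′ ∣ ≥ 98 * ∣ A ∣ → 100 * ∣ B′ ∣ ≥ 98 * ∣ A ∣ → ¬ Copy (induced D₀ (A′ ∪ B′)) R) ×
      (100 * ∣ A′ ∣ ≥ ∣ A ∣ → 100 * ∣ B′ ∣ ≥ ∣ A ∣ → edgesBetween D₀ A′ B′ > 0))
  result =
    let M , M≡ , M≤ = order-R
        D₀ , A , B , R , bip , ∣A∣≡∣B∣ , ∣B∣≤n , deg , tour , ord , props =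
          Construction.construction q Δ (2 ^ q) s (Fin.fromℕ< (<-≤-trans 0<Δ Δ≤n)) 2≤q 2≤2^q ≤-refl labels≤
            degree≤ Δ≤n 1000≤n {{>-nonZero 1≤s}} parts≤ M≤
    in  n + n , D₀ , A , B , M , R , bip , ∣A∣≡∣B∣ , ∣B∣≤n , deg , tour , trans (cong ℤ.+_ ord) M≡ , props

-- Each vertex of A chooses d = 160000 q neighbours with q = 2⌊Δ/κ⌋, and 1000 d ≤ Δ keeps
-- vertices of too large in-degree rare; hence κ = 2 · 160000 · 1000.
abstract
  constants : ∃ λ κ → ∃ λ N → NonZero κ × NonZero N × κ ≡ 320000000 × suc N ≡ κ * 2 * 2 × κ * 4 * 40 ≤ 2 ^ 40
  constants = 320000000 , 1279999999 , >-nonZero (s≤s z≤n) , >-nonZero (s≤s z≤n) , refl , refl ,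
    toWitness {a? = 320000000 * 4 * 40 ≤? 2 ^ 40} _

open import Data.Integer using (+_)

-- A rational base loses nothing against a real one: decreasing c′ only passes
-- to a subtournament of R.
lemma3p4 :
  Σ ℚ λ c′ → c′ ℚ.> 1ℚ × (Σ ℕ λ Δ₀ →
    ∀ (Δ n : ℕ) → Δ ≥ Δ₀ → n ≥ Δ →
    Σ ℕ λ N → Σ (Digraph N) λ D₀ → Σ (Subset N) λ A → Σ (Subset N) λ B →
    Σ ℕ λ M → Σ (Digraph M) λ R →
      DirectedBipartite D₀ A B × ∣ A ∣ ≡ ∣ B ∣ × ∣ B ∣ ≤ n ×
      maxDegree D₀ ≡ Δ ×
      Tournament R × + order R ≡ floor (c′ ^ℚ Δ ℚ.* fromℕ n) ×
      (∀ (A′ B′ : Subset N) → A′ ⊆ A → B′ ⊆ B →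
        -- ∣A′∣, ∣B′∣ ≥ 0.98 ∣A∣, with denominators cleared
        (100 * ∣ A′ ∣ ≥ 98 * ∣ A ∣ → 100 * ∣ B′ ∣ ≥ 98 * ∣ A ∣ →
          ¬ Copy (induced D₀ (A′ ∪ B′)) R) ×
        -- ∣A′∣, ∣B′∣ ≥ 0.01 ∣A∣
        (100 * ∣ A′ ∣ ≥ ∣ A ∣ → 100 * ∣ B′ ∣ ≥ ∣ A ∣ →
          edgesBetween D₀ A′ B′ > 0)))
lemma3p4 =
  let κ , N , κ≢0 , N≢0 , κ≡ , N≡ , κ-small = constants
      instance
        _ = κ≢0
        _ = N≢0
  in  + suc N ℚ./ N , fraction->1 (+ suc N ℚ./ N) N (>-nonZero⁻¹ N) (fraction-/ (suc N) N) ,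
      40 * κ , Parameters.result κ N κ≡ N≡ κ-small
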